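{- For every integer $n \ge 1$, $\mathsf{Opt}(F_n) = \mathsf{RePair}(F_n)$. That is, every grammar of $F_n$ produced by any implementation of RePair is a smallest grammar of $F_n$, and every smallest grammar of $F_n$ is (up to equivalence) produced by some implementation of RePair.
   Context: Fibonacci words over $\{\mathtt{a},\mathtt{b}\}$: $F_1=\mathtt{b}$, $F_2=\mathtt{a}$, $F_i=F_{i-1}F_{i-2}$ for $i\ge 3$. A grammar of a string $w$ is a straight-line program (SLP): a context-free grammar in Chomsky normal form deriving exactly $w$, with productions $X_i\to\alpha$ ($\alpha$ a terminal) or $X_i\to X_jX_k$ with $j,k<i$. Its size $|G|$ is the number of productions. Two grammars deriving the same string are equivalent if there is a bijective renaming of non-terminals transforming the derivation tree of one into that of the other; sets of grammars are taken up to this equivalence (one representative per class). $\mathsf{Opt}(w)$ is the set of all grammars of $w$ of minimum size. RePair on $w$: (1) replace each terminal by a non-terminal (creating unary productions); (2) repeatedly choose an arbitrary bigram having the maximum number of non-overlapping occurrences in the current string and replace all possible (non-overlapping, left-to-right) occurrences of it by a fresh non-terminal $X$, adding the production $X\to$ (that bigram), until no bigram has two or more non-overlapping occurrences; (3) combine the remaining sequence of non-terminals by binary productions into a single start symbol. Different choices among tied most frequent bigrams (and in the final combination) give different grammars; $\mathsf{RePair}(w)$ is the set of all grammars obtainable this way. -}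

module Defs where

open import Data.Nat using (ℕ; zero; suc; _≤_; _<_; _<?_)
open import Data.Fin using (Fin; toℕ; fromℕ; fromℕ<; inject₁; _≟_)
open import Data.List using (List; []; _∷_; _++_; map; [_])
open import Data.List.Membership.Propositional using (_∈_)
open import Data.List.Relation.Binary.Pointwise using (Pointwise)
open import Data.Bool using (true; false; _∧_)
open import Data.Product using (Σ; ∃; ∃-syntax; Σ-syntax; _×_)
open import Function.Bundles using (_⤖_; Bijection)
open import Relation.Nullary using (does; yes; no)
open import Relation.Binary.PropositionalEquality using (_≡_)

data Letter : Set where
  a b : Letter

-- fib n = F_n : F_1 = b, F_2 = a, F_i = F_{i-1} F_{i-2}  (fib 0 unused)
fib : ℕ → List Letter
fib zero = []
fib (suc zero) = [ b ]
fib (suc (suc zero)) = [ a ]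
fib (suc (suc (suc n))) = fib (suc (suc n)) ++ fib (suc n)

data Rule (n : ℕ) : Set where
  leaf : Letter → Rule n
  node : Fin n → Fin n → Rule n

wkRule : ∀ {n} → Rule n → Rule (suc n)
wkRule (leaf c) = leaf c
wkRule (node j k) = node (inject₁ j) (inject₁ k)

mapRule : ∀ {n m} → (Fin n → Fin m) → Rule n → Rule m
mapRule π (leaf c) = leaf c
mapRule π (node j k) = node (π j) (π k)

-- SLP n : a list of n productions X_0,...,X_{n-1}; production X_i may
-- only refer to X_j with j < i (the telescope enforces this).
infixl 5 _▷_
data SLP : ℕ → Set where
  []  : SLP zero
  _▷_ : ∀ {n} → SLP n → Rule n → SLP (suc n)

lookup : ∀ {n} → SLP n → Fin n → Rule n
lookup {suc n} (G ▷ r) i with toℕ i <? n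
... | yes p = wkRule (lookup G (fromℕ< p))
... | no _  = wkRule r

data Derives {n : ℕ} (G : SLP n) : Fin n → List Letter → Set where
  dleaf : ∀ {i c} → lookup G i ≡ leaf c → Derives G i [ c ]
  dnode : ∀ {i j k u v} → lookup G i ≡ node j k →
          Derives G j u → Derives G k v → Derives G i (u ++ v)

-- A grammar is a nonempty SLP; its start symbol is the last non-terminal.
-- The size of G : SLP (suc m) is suc m (number of productions).
start : ∀ {m} → Fin (suc m)
start {m} = fromℕ m

GrammarOf : ∀ {m} → SLP (suc m) → List Letter → Set
GrammarOf G w = Derives G start w

Opt : List Letter → ∀ {m} → SLP (suc m) → Set
Opt w {m} G = GrammarOf G w ×
  (∀ {m'} (H : SLP (suc m')) → GrammarOf H w → suc m ≤ suc m')

_≅_ : ∀ {m m'} → SLP (suc m) → SLP (suc m') → Set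
_≅_ {m} {m'} G H = Σ (Fin (suc m) ⤖ Fin (suc m')) λ π →
  (∀ i → lookup H (Bijection.to π i) ≡ mapRule (Bijection.to π) (lookup G i)) ×
  (Bijection.to π start ≡ start)

-- number of non-overlapping occurrences of bigram xy in s, counted
-- greedily left to right (this is the maximum number for a bigram)
count : ∀ {n} → Fin n → Fin n → List (Fin n) → ℕ
countFrom : ∀ {n} → Fin n → Fin n → Fin n → List (Fin n) → ℕ
count x y [] = zero
count x y (c ∷ r) = countFrom x y c r
countFrom x y c [] = zero
countFrom x y c (d ∷ r) with does (c ≟ x) ∧ does (d ≟ y)
... | true  = suc (count x y r)
... | false = countFrom x y d r

replace : ∀ {n} → Fin n → Fin n → List (Fin n) → List (Fin (suc n))
replaceFrom : ∀ {n} → Fin n → Fin n → Fin n → List (Fin n) → List (Fin (suc n))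
replace x y [] = []
replace x y (c ∷ r) = replaceFrom x y c r
replaceFrom x y c [] = inject₁ c ∷ []
replaceFrom {n} x y c (d ∷ r) with does (c ≟ x) ∧ does (d ≟ y)
... | true  = fromℕ n ∷ replace x y r
... | false = inject₁ c ∷ replaceFrom x y d r

-- Step (1): one unary production per distinct letter of w (in any order),
-- and the current string s spells w.
InitState : List Letter → ∀ {n} → SLP n → List (Fin n) → Set
InitState w {n} G s =
  (∀ i → ∃[ c ] lookup G i ≡ leaf c) ×
  (∀ i j c → lookup G i ≡ leaf c → lookup G j ≡ leaf c → i ≡ j) ×
  (∀ i → i ∈ s) ×
  Pointwise (λ i c → lookup G i ≡ leaf c) s w

-- Step (3): combine the remaining sequence by binary productions
-- (any bracketing, one fresh production per internal node) into a
-- single start symbol.  Combine G s H : starting from grammar G and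
-- sequence s, the final grammar H is obtained.
data Combine : ∀ {n} → SLP n → List (Fin n) → ∀ {m} → SLP m → Set where
  done  : ∀ {k} (G : SLP (suc k)) → Combine G [ fromℕ k ] G
  merge : ∀ {n} {G : SLP n} (u : List (Fin n)) (x y : Fin n) (v : List (Fin n))
            {m} {H : SLP m} →
          Combine (G ▷ node x y) (map inject₁ u ++ fromℕ n ∷ map inject₁ v) H →
          Combine G (u ++ x ∷ y ∷ v) H

data Replace : ∀ {n} → SLP n → List (Fin n) → ∀ {m} → SLP m → Set where
  stop : ∀ {n} {G : SLP n} {s : List (Fin n)} {m} {H : SLP m} →
         (∀ x y → count x y s < 2) → Combine G s H → Replace G s H
  step : ∀ {n} {G : SLP n} {s : List (Fin n)} {m} {H : SLP m} (x y : Fin n) →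
         2 ≤ count x y s → (∀ x' y' → count x' y' s ≤ count x y s) →
         Replace (G ▷ node x y) (replace x y s) H → Replace G s H

RePair : List Letter → ∀ {m} → SLP (suc m) → Set
RePair w H = ∃[ n ] Σ[ G ∈ SLP n ] Σ[ s ∈ List (Fin n) ]
  (InitState w G s × Replace G s H)

{-# OPTIONS --safe #-}
module Submission where

-- The factorization gives more than a size bound because of an exact balance. A phrase that is the
-- single letter b arises exactly where an expanded rule has b as a child. So the other phrases plus
-- the uses of b number one more than the expanded rules. One use of b is unavoidable, and this
-- yields the lower bound on the size; every further use costs one more rule, and this makes the
-- rule using b unique. That is why b is left out of the count of forced phrases.
--
-- After one step the argument is repeated on a word that need not be a Fibonacci word, so the
-- phrase bound has to hold for every word that can arise. The given grammar is never rewritten. At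
-- each level a map `term` says which non-terminals currently act as letters, and the RePair grammar
-- grows as an injective image inside the given one. Optimality is passed on only as a bound on the
-- number of non-terminals not yet matched.

-- Let σ be a ↦ ab, b ↦ a and let P_j be the palindrome with F_j = P_j ab or
-- P_j ba. RePair replaces ab in F_j = σ(F_{j-1}) and gets F_{j-1}; only if F_j ends in
-- ba it may replace ba instead, which leads to b P_{j-1} a, and from then on
-- bPa and aPb alternate with forced choices. So every run has j - 2 binary rules.
--
-- Conversely, traverse the derivation tree of a grammar from left to right,
-- expanding each non-terminal once. This factors the word into letters and
-- copies of earlier factors, with one phrase more than there are binary rules.
-- The words z P_{j-1} z are not factors of P_{j+1} (which has period |F_{j-1}|,
-- so all its windows of that length contain equally many b's); this forces
-- j - 2 phrases other than the single letter b. Hence at least j - 2 binary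
-- rules, and with exactly j - 2 the letter b is used only once. Comparing the
-- numbers of a's and b's, it is used in a rule X → ab or X → ba. Taking X and a
-- as the new letters turns the grammar into an optimal one at level j - 1, and
-- the rule is a legitimate RePair step.

open import Defs
open import Data.Bool using (Bool; true; false; not; _∧_)
open import Data.Empty using (⊥; ⊥-elim)
open import Data.Fin using (Fin; zero; suc; toℕ; fromℕ; fromℕ<; inject₁; _≟_)
open import Data.Fin.Properties
  using (toℕ-fromℕ; toℕ-inject₁; toℕ-fromℕ<; inject₁ℕ<; fromℕ≢inject₁; injective⇒≤; toℕ-injective; any?)
open import Data.Fin.Relation.Unary.Top using (view; ‵fromℕ; ‵inject₁; view-fromℕ; view-inject₁)
import Data.List as List
open import Data.List using (List; []; _∷_; _++_; [_]; length; reverse; map; tabulate)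
open import Data.List.Properties
  using (++-assoc; ++-identityʳ; ++-cancelʳ; length-++; length-++-≤ˡ; length-map; length-tabulate; map-++; map-id;
         map-∘; reverse-++; reverse-involutive; unfold-reverse; ∷-injective; ∷-injectiveˡ; ∷-injectiveʳ;
         ∷ʳ-injectiveʳ)
open import Data.List.Membership.Propositional using (_∈_)
open import Data.List.Membership.Propositional.Properties using (∈-lookup)
open import Data.List.Relation.Binary.Pointwise using (Pointwise; []; _∷_)
open import Data.List.Relation.Unary.All using (All; []; _∷_)
import Data.List.Relation.Unary.All as All
import Data.List.Relation.Unary.All.Properties as All
open import Data.List.Relation.Unary.AllPairs using ([]; _∷_)
open import Data.List.Relation.Unary.Any using (here; there)
open import Data.List.Relation.Unary.Unique.Propositional using (Unique)
open import Data.List.Relation.Unary.Unique.Propositional.Properties using (tabulate⁺)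
open import Data.Maybe using (Maybe; just; nothing)
open import Data.Maybe.Properties using (just-injective)
open import Data.Nat using (ℕ; zero; suc; _+_; _≤_; _<_; z≤n; s≤s; _≤?_; _<?_)
open import Data.Nat.Properties hiding (_≟_)
open import Data.Nat.Tactic.RingSolver using (solve-∀)
open import Data.Product using (∃-syntax; Σ-syntax; _×_; _,_; proj₁; proj₂)
open import Data.Sum using (_⊎_; inj₁; inj₂)
open import Function.Bundles using (mk⤖)
open import Relation.Nullary using (¬_; yes; no; does)
open import Relation.Nullary.Decidable using (dec-true; dec-false)
open import Relation.Binary.PropositionalEquality hiding ([_])
open ≡-Reasoning

-- The morphisms, the palindromes and the forbidden factors

σ τ : List Letter → List Letter
σ []      = []
σ (a ∷ w) = a ∷ b ∷ σ w
σ (b ∷ w) = a ∷ σ w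
τ []      = []
τ (a ∷ w) = b ∷ a ∷ τ w
τ (b ∷ w) = a ∷ τ w

σ-++ : ∀ u v → σ (u ++ v) ≡ σ u ++ σ v
σ-++ []      v = refl
σ-++ (a ∷ u) v = cong (λ w → a ∷ b ∷ w) (σ-++ u v)
σ-++ (b ∷ u) v = cong (a ∷_) (σ-++ u v)

τ-++ : ∀ u v → τ (u ++ v) ≡ τ u ++ τ v
τ-++ []      v = refl
τ-++ (a ∷ u) v = cong (λ w → b ∷ a ∷ w) (τ-++ u v)
τ-++ (b ∷ u) v = cong (a ∷_) (τ-++ u v)

-- `σ` and `τ` are conjugate by `a`, so `pal (1 + i)` is both `σ (pal i) ++ [ a ]` and
-- `a ∷ τ (pal i)`. As reversal exchanges `σ` and `τ`, this makes it a palindrome; it also lets some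
-- words be desubstituted in two ways.
σ-τ-conjugate : ∀ w → σ w ++ [ a ] ≡ a ∷ τ w
σ-τ-conjugate []      = refl
σ-τ-conjugate (a ∷ w) = cong (λ v → a ∷ b ∷ v) (σ-τ-conjugate w)
σ-τ-conjugate (b ∷ w) = cong (a ∷_) (σ-τ-conjugate w)

σ-injective : ∀ u v → σ u ≡ σ v → u ≡ v
σ-injective []      []      _ = refl
σ-injective []      (a ∷ v) ()
σ-injective []      (b ∷ v) ()
σ-injective (a ∷ u) []      ()
σ-injective (b ∷ u) []      ()
σ-injective (a ∷ u) (a ∷ v) e = cong (a ∷_) (σ-injective u v (∷-injectiveʳ (∷-injectiveʳ e)))
σ-injective (b ∷ u) (b ∷ v) e = cong (b ∷_) (σ-injective u v (∷-injectiveʳ e))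
σ-injective (a ∷ u) (b ∷ []) ()
σ-injective (a ∷ u) (b ∷ a ∷ v) ()
σ-injective (a ∷ u) (b ∷ b ∷ v) ()
σ-injective (b ∷ []) (a ∷ v) ()
σ-injective (b ∷ a ∷ u) (a ∷ v) ()
σ-injective (b ∷ b ∷ u) (a ∷ v) ()

τ-injective : ∀ u v → τ u ≡ τ v → u ≡ v
τ-injective u v e = σ-injective u v (++-cancelʳ [ a ] (σ u) (σ v)
  (trans (σ-τ-conjugate u) (trans (cong (a ∷_) e) (sym (σ-τ-conjugate v)))))

σ-head≢b : ∀ u {w} → σ u ≢ b ∷ w
σ-head≢b []      ()
σ-head≢b (a ∷ u) ()
σ-head≢b (b ∷ u) ()

τ-last≢b : ∀ u {w} → τ u ≢ w ++ [ b ]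
τ-last≢b [] {[]} ()
τ-last≢b [] {c ∷ w} ()
τ-last≢b (b ∷ u) {[]} ()
τ-last≢b (b ∷ u) {c ∷ w} e = τ-last≢b u (∷-injectiveʳ e)
τ-last≢b (a ∷ u) {[]} ()
τ-last≢b (a ∷ u) {c ∷ []} ()
τ-last≢b (a ∷ u) {c ∷ d ∷ w} e = τ-last≢b u (∷-injectiveʳ (∷-injectiveʳ e))

reverse-σ : ∀ w → reverse (σ w) ≡ τ (reverse w)
reverse-σ []      = refl
reverse-σ (a ∷ w) = begin
  reverse ((a ∷ b ∷ []) ++ σ w)      ≡⟨ reverse-++ (a ∷ b ∷ []) (σ w) ⟩
  reverse (σ w) ++ τ [ a ]           ≡⟨ cong (_++ τ [ a ]) (reverse-σ w) ⟩
  τ (reverse w) ++ τ [ a ]           ≡⟨ τ-++ (reverse w) [ a ] ⟨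
  τ (reverse w ++ [ a ])             ≡⟨ cong τ (unfold-reverse a w) ⟨
  τ (reverse (a ∷ w))                ∎
reverse-σ (b ∷ w) = begin
  reverse ([ a ] ++ σ w)             ≡⟨ reverse-++ [ a ] (σ w) ⟩
  reverse (σ w) ++ τ [ b ]           ≡⟨ cong (_++ τ [ b ]) (reverse-σ w) ⟩
  τ (reverse w) ++ τ [ b ]           ≡⟨ τ-++ (reverse w) [ b ] ⟨
  τ (reverse w ++ [ b ])             ≡⟨ cong τ (unfold-reverse b w) ⟨
  τ (reverse (b ∷ w))                ∎

occ : Letter → List Letter → ℕ
occ c []      = 0
occ a (a ∷ w) = suc (occ a w)
occ a (b ∷ w) = occ a w
occ b (a ∷ w) = occ b w
occ b (b ∷ w) = suc (occ b w)

occ-++ : ∀ c u v → occ c (u ++ v) ≡ occ c u + occ c v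
occ-++ c []      v = refl
occ-++ a (a ∷ u) v = cong suc (occ-++ a u v)
occ-++ a (b ∷ u) v = occ-++ a u v
occ-++ b (a ∷ u) v = occ-++ b u v
occ-++ b (b ∷ u) v = cong suc (occ-++ b u v)

occ-a-σ : ∀ w → occ a (σ w) ≡ occ a w + occ b w
occ-a-σ []      = refl
occ-a-σ (a ∷ w) = cong suc (occ-a-σ w)
occ-a-σ (b ∷ w) = trans (cong suc (occ-a-σ w)) (sym (+-suc (occ a w) (occ b w)))

occ-b-σ : ∀ w → occ b (σ w) ≡ occ a w
occ-b-σ []      = refl
occ-b-σ (a ∷ w) = cong suc (occ-b-σ w)
occ-b-σ (b ∷ w) = occ-b-σ w

occ-a-τ : ∀ w → occ a (τ w) ≡ occ a w + occ b w
occ-a-τ []      = refl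
occ-a-τ (a ∷ w) = cong suc (occ-a-τ w)
occ-a-τ (b ∷ w) = trans (cong suc (occ-a-τ w)) (sym (+-suc (occ a w) (occ b w)))

occ-b-τ : ∀ w → occ b (τ w) ≡ occ a w
occ-b-τ []      = refl
occ-b-τ (a ∷ w) = cong suc (occ-b-τ w)
occ-b-τ (b ∷ w) = occ-b-τ w

odd : ℕ → Bool
odd zero    = false
odd (suc i) = not (odd i)

-- Writing P_j for F_j without its last two letters, pal i is P_{i+3} and
-- ends (odd i) are the two letters cut off.
ends : Bool → List Letter
ends false = a ∷ b ∷ []
ends true  = b ∷ a ∷ []

pal : ℕ → List Letter
pal zero    = []
pal (suc i) = σ (pal i) ++ [ a ]

-- The map `w ↦ σ w ++ [ a ]` sends `pal i` to `pal (1 + i)`. It respects a splitting around `ab` or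
-- `ba` and swaps that pair, so the two splittings of `pal (2 + i)` below follow by induction.
σ-glue : ∀ x o y → σ (x ++ ends o ++ y) ++ [ a ] ≡ (σ x ++ [ a ]) ++ ends (not o) ++ (σ y ++ [ a ])
σ-glue x o y = begin
  σ (x ++ ends o ++ y) ++ [ a ]                 ≡⟨ cong (_++ [ a ]) (σ-++ x (ends o ++ y)) ⟩
  (σ x ++ σ (ends o ++ y)) ++ [ a ]             ≡⟨ ++-assoc (σ x) _ _ ⟩
  σ x ++ σ (ends o ++ y) ++ [ a ]               ≡⟨ cong (σ x ++_) (lem o) ⟩
  σ x ++ a ∷ ends (not o) ++ (σ y ++ [ a ])     ≡⟨ ++-assoc (σ x) [ a ] _ ⟨
  (σ x ++ [ a ]) ++ ends (not o) ++ (σ y ++ [ a ]) ∎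
  where
  lem : ∀ o → σ (ends o ++ y) ++ [ a ] ≡ a ∷ ends (not o) ++ (σ y ++ [ a ])
  lem false = refl
  lem true  = refl

pal-right : ∀ i → pal (2 + i) ≡ pal (1 + i) ++ ends (not (odd i)) ++ pal i
pal-right zero    = refl
pal-right (suc i) = trans (cong (λ w → σ w ++ [ a ]) (pal-right i))
                          (σ-glue (pal (1 + i)) (not (odd i)) (pal i))

-- Next to `pal-right` this makes `pal (1 + i)` a suffix as well as a prefix of `pal (2 + i)`, which
-- therefore has the period `length (pal i) + 2` with period word `pal i ++ ends (odd i)`.
pal-left : ∀ i → pal (2 + i) ≡ pal i ++ ends (odd i) ++ pal (1 + i)
pal-left zero    = refl
pal-left (suc i) = trans (cong (λ w → σ w ++ [ a ]) (pal-left i))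
                         (σ-glue (pal i) (odd i) (pal (1 + i)))

reverse-pal : ∀ i → reverse (pal i) ≡ pal i
reverse-pal zero    = refl
reverse-pal (suc i) = begin
  reverse (σ (pal i) ++ [ a ])  ≡⟨ reverse-++ (σ (pal i)) [ a ] ⟩
  a ∷ reverse (σ (pal i))       ≡⟨ cong (a ∷_) (reverse-σ (pal i)) ⟩
  a ∷ τ (reverse (pal i))       ≡⟨ cong (λ w → a ∷ τ w) (reverse-pal i) ⟩
  a ∷ τ (pal i)                 ≡⟨ σ-τ-conjugate (pal i) ⟨
  σ (pal i) ++ [ a ]            ∎

fib-pal : ∀ i → fib (3 + i) ≡ pal i ++ ends (odd i)
fib-pal zero          = refl
fib-pal (suc zero)    = refl
fib-pal (suc (suc i)) = begin
  fib (4 + i) ++ fib (3 + i)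
    ≡⟨ cong₂ _++_ (fib-pal (suc i)) (fib-pal i) ⟩
  (pal (1 + i) ++ ends (not (odd i))) ++ pal i ++ ends (odd i)
    ≡⟨ ++-assoc (pal (1 + i)) _ _ ⟩
  pal (1 + i) ++ ends (not (odd i)) ++ pal i ++ ends (odd i)
    ≡⟨ cong (pal (1 + i) ++_) (++-assoc (ends (not (odd i))) (pal i) _) ⟨
  pal (1 + i) ++ (ends (not (odd i)) ++ pal i) ++ ends (odd i)
    ≡⟨ ++-assoc (pal (1 + i)) _ _ ⟨
  (pal (1 + i) ++ ends (not (odd i)) ++ pal i) ++ ends (odd i)
    ≡⟨ cong₂ _++_ (pal-right i) (cong ends (not-not (odd i))) ⟨
  pal (2 + i) ++ ends (not (not (odd i))) ∎
  where
  not-not : ∀ o → not (not o) ≡ o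
  not-not false = refl
  not-not true  = refl

occ-b<occ-a-pal : ∀ i → occ b (pal (suc i)) < occ a (pal (suc i))
occ-b<occ-a-pal i
  rewrite occ-++ b (σ (pal i)) [ a ] | occ-++ a (σ (pal i)) [ a ]
        | occ-a-σ (pal i) | occ-b-σ (pal i)
        | +-identityʳ (occ a (pal i)) | +-comm (occ a (pal i) + occ b (pal i)) 1
  = s≤s (m≤m+n _ _)

-- Factors and periodicity

Factor : List Letter → List Letter → Set
Factor u w = ∃[ p ] ∃[ r ] w ≡ p ++ u ++ r

++-split : ∀ {A : Set} (xs : List A) {ys zs ws} → xs ++ ys ≡ zs ++ ws →
  (∃[ r ] (zs ≡ xs ++ r × ys ≡ r ++ ws)) ⊎
  (∃[ c ] ∃[ r ] (xs ≡ zs ++ c ∷ r × ws ≡ c ∷ r ++ ys))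
++-split [] {zs = zs} e = inj₁ (zs , refl , e)
++-split (x ∷ xs) {zs = []} e = inj₂ (x , xs , refl , sym e)
++-split (x ∷ xs) {zs = z ∷ zs} e with ∷-injective e
... | refl , e′ with ++-split xs {zs = zs} e′
... | inj₁ (r , refl , q) = inj₁ (r , refl , q)
... | inj₂ (c , r , refl , q) = inj₂ (c , r , refl , q)

factor-grow : ∀ {u w} x y → Factor u w → Factor u (x ++ w ++ y)
factor-grow {u} x y (p , r , refl) = x ++ p , r ++ y , lem
  where
  lem : x ++ (p ++ u ++ r) ++ y ≡ (x ++ p) ++ u ++ r ++ y
  lem = trans (cong (x ++_) (trans (++-assoc p (u ++ r) y) (cong (p ++_) (++-assoc u r y))))
              (sym (++-assoc x p _))

factor-++ʳ : ∀ {u w} y → Factor u w → Factor u (w ++ y)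
factor-++ʳ = factor-grow []

factor-inner : ∀ {w} x u y → Factor (x ++ u ++ y) w → Factor u w
factor-inner x u y (p , r , refl) = p ++ x , y ++ r , lem
  where
  lem : p ++ (x ++ u ++ y) ++ r ≡ (p ++ x) ++ u ++ y ++ r
  lem = trans (cong (p ++_) (trans (++-assoc x (u ++ y) r) (cong (x ++_) (++-assoc u y r))))
              (sym (++-assoc p x _))

¬factor-empty : ∀ {c u} → ¬ Factor (c ∷ u) []
¬factor-empty ([] , _ , ())
¬factor-empty (_ ∷ _ , _ , ())

factor-tail : ∀ {c d u w} → c ≢ d → Factor (c ∷ u) (d ∷ w) → Factor (c ∷ u) w
factor-tail c≢d ([] , r , e)    = ⊥-elim (c≢d (sym (∷-injectiveˡ e)))
factor-tail c≢d (_ ∷ p , r , e) = p , r , ∷-injectiveʳ e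

factor-init : ∀ {c d u w} → c ≢ d → Factor (u ++ [ c ]) (w ++ [ d ]) → Factor (u ++ [ c ]) w
factor-init {c} {d} {u} {w} c≢d (p , r , e)
  with ++-split w {ys = [ d ]} {zs = p ++ u ++ [ c ]} {ws = r}
         (trans e (trans refl (sym (++-assoc p (u ++ [ c ]) r))))
... | inj₂ (x , r′ , e₁ , _) = p , x ∷ r′ , trans e₁ (++-assoc p (u ++ [ c ]) (x ∷ r′))
... | inj₁ ([] , e₁ , _) = p , [] , sym (trans (cong (p ++_) (++-identityʳ _)) (trans e₁ (++-identityʳ w)))
... | inj₁ (x ∷ r′ , e₁ , e₂) = ⊥-elim (c≢d (lem w (∷-injectiveˡ e₂) (tail-nil r′ (∷-injectiveʳ e₂)) (trans (++-assoc p u [ c ]) e₁)))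
  where
  tail-nil : ∀ r′ {r : List Letter} → [] ≡ r′ ++ r → r′ ≡ []
  tail-nil [] _ = refl
  lem : ∀ w {r′} → d ≡ x → r′ ≡ [] → (p ++ u) ++ [ c ] ≡ w ++ x ∷ r′ → c ≡ d
  lem w refl refl e = ∷ʳ-injectiveʳ (p ++ u) w e

++-cancel-length : ∀ {A : Set} (u : List A) {v g r} → u ++ v ≡ g ++ r → length g ≡ length u → g ≡ u
++-cancel-length []      {g = []}    _ _ = refl
++-cancel-length (x ∷ u) {g = y ∷ g} e l with ∷-injective e
... | refl , e′ = cong (x ∷_) (++-cancel-length u e′ (suc-injective l))

-- All windows of length p in a word with period p are conjugate.
periodic-window : ∀ u s p {t g r} → u ++ s ≡ s ++ t → u ++ s ≡ p ++ g ++ r →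
                  length g ≡ length u → occ b g ≡ occ b u
periodic-window u s [] {g = g} per e l = cong (occ b) (++-cancel-length u {g = g} e l)
periodic-window [] s (c ∷ p) {g = []} per e l = refl
periodic-window (d ∷ u) [] (c ∷ p) {g = g} {r} per e l =
  ⊥-elim (<-irrefl refl (≤-trans (≤-reflexive (sym l)) shorter))
  where
  shorter : length g ≤ length u
  shorter = ≤-trans (≤-trans (m≤m+n (length g) (length r)) (m≤n+m _ (length p)))
    (≤-reflexive (sym (trans (cong length (trans (sym (++-identityʳ u)) (∷-injectiveʳ e)))
      (trans (length-++ p) (cong (length p +_) (length-++ g))))))
periodic-window (d ∷ u) (x ∷ s) (c ∷ p) {t} {g} per e l with ∷-injectiveˡ per
-- Moving past the first letter turns the period word `d ∷ u` into its rotation `u ++ [ d ]`, which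
-- has equally many letters `b`.
... | refl = trans (periodic-window (u ++ [ d ]) s p {g = g}
                 (trans (++-assoc u [ d ] s) (∷-injectiveʳ per))
                 (trans (++-assoc u [ d ] s) (∷-injectiveʳ e))
                 (trans l (trans (+-comm 1 (length u)) (sym (length-++ u)))))
               (trans (occ-++ b u [ d ]) (trans (+-comm (occ b u) _) (sym (occ-++ b [ d ] u))))

-- z P z has 0 or 2 letters b outside P, whereas the period word has 1.
¬singular : ∀ z i → ¬ Factor (z ∷ pal i ++ [ z ]) (pal (2 + i))
¬singular z i (p , r , e) = contra z (trans (sym (lhs z)) (trans eq (rhs (odd i))))
  where
  u s : List Letter
  u = pal i ++ ends (odd i)
  s = pal (1 + i)
  us : pal (2 + i) ≡ u ++ s
  us = trans (pal-left i) (sym (++-assoc (pal i) (ends (odd i)) s))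
  len : ∀ o → length (z ∷ pal i ++ [ z ]) ≡ length (pal i ++ ends o)
  len o = trans (cong suc (length-++ (pal i))) (trans (sym (+-suc (length (pal i)) 1))
          (trans (cong (length (pal i) +_) (two o)) (sym (length-++ (pal i)))))
    where
    two : ∀ o → 2 ≡ length (ends o)
    two false = refl
    two true  = refl
  eq : occ b (z ∷ pal i ++ [ z ]) ≡ occ b u
  eq = periodic-window u s p (trans (sym us) (pal-right i)) (trans (sym us) e) (len (odd i))
  lhs : ∀ z → occ b (z ∷ pal i ++ [ z ]) ≡ occ b (pal i) + (occ b [ z ] + occ b [ z ])
  lhs a = occ-++ b (pal i) [ a ]
  lhs b = trans (cong suc (occ-++ b (pal i) [ b ])) (sym (+-suc _ 1))
  rhs : ∀ o → occ b (pal i ++ ends o) ≡ occ b (pal i) + 1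
  rhs false = occ-++ b (pal i) _
  rhs true  = occ-++ b (pal i) _
  contra : ∀ z → occ b (pal i) + (occ b [ z ] + occ b [ z ]) ≢ occ b (pal i) + 1
  contra a e with +-cancelˡ-≡ (occ b (pal i)) _ _ e
  ... | ()
  contra b e with +-cancelˡ-≡ (occ b (pal i)) _ _ e
  ... | ()

-- Marked factorizations

-- good and bad mark the first letter of a phrase; the phrase is bad if it is a
-- single letter b that is not a copy.
data Mark : Set where
  good bad cont : Mark

Marked : Set
Marked = List (Mark × Letter)

letters : Marked → List Letter
letters = map proj₂

goods bads : Marked → ℕ
goods []               = 0
goods ((good , _) ∷ M) = suc (goods M)
goods ((bad  , _) ∷ M) = goods M
goods ((cont , _) ∷ M) = goods M
bads []                = 0
bads ((good , _) ∷ M)  = bads M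
bads ((bad  , _) ∷ M)  = suc (bads M)
bads ((cont , _) ∷ M)  = bads M

goods-++ : ∀ M N → goods (M ++ N) ≡ goods M + goods N
goods-++ []               N = refl
goods-++ ((good , _) ∷ M) N = cong suc (goods-++ M N)
goods-++ ((bad  , _) ∷ M) N = goods-++ M N
goods-++ ((cont , _) ∷ M) N = goods-++ M N

bads-++ : ∀ M N → bads (M ++ N) ≡ bads M + bads N
bads-++ []               N = refl
bads-++ ((good , _) ∷ M) N = bads-++ M N
bads-++ ((bad  , _) ∷ M) N = cong suc (bads-++ M N)
bads-++ ((cont , _) ∷ M) N = bads-++ M N

copied : Letter → List Letter → Marked
copied c v = (good , c) ∷ map (cont ,_) v

letters-copied : ∀ c v → letters (copied c v) ≡ c ∷ v
letters-copied c v = cong (c ∷_) (trans (sym (map-∘ v)) (map-id v))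

goods-copied : ∀ c v → goods (copied c v) ≡ 1
goods-copied c v = cong suc (lem v)
  where
  lem : ∀ v → goods (map (cont ,_) v) ≡ 0
  lem []      = refl
  lem (_ ∷ v) = lem v

bads-copied : ∀ c v → bads (copied c v) ≡ 0
bads-copied c []      = refl
bads-copied c (_ ∷ v) = bads-copied c v

-- A copied phrase must not overlap its source, so Factor looks only at the text
-- q in front of the phrase.
data LZ : List Letter → Marked → Set where
  []       : ∀ {q} → LZ q []
  letter-a : ∀ {q M} → LZ (q ++ [ a ]) M → LZ q ((good , a) ∷ M)
  letter-b : ∀ {q M} → LZ (q ++ [ b ]) M → LZ q ((bad , b) ∷ M)
  copy     : ∀ {q M} c v → Factor (c ∷ v) q → LZ (q ++ c ∷ v) M → LZ q (copied c v ++ M)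

LZ-++ : ∀ {q M N} → LZ q M → LZ (q ++ letters M) N → LZ q (M ++ N)
LZ-++ {q} {N = N} [] z = subst (λ q → LZ q N) (++-identityʳ q) z
LZ-++ {q} {N = N} (letter-a {M = M} y) z =
  letter-a (LZ-++ y (subst (λ q → LZ q N) (sym (++-assoc q [ a ] (letters M))) z))
LZ-++ {q} {N = N} (letter-b {M = M} y) z =
  letter-b (LZ-++ y (subst (λ q → LZ q N) (sym (++-assoc q [ b ] (letters M))) z))
LZ-++ {q} {N = N} (copy {M = M} c v f y) z = subst (LZ q) (sym (++-assoc (copied c v) M N))
  (copy c v f (LZ-++ y (subst (λ q → LZ q N) eq z)))
  where
  eq : q ++ letters (copied c v ++ M) ≡ (q ++ c ∷ v) ++ letters M
  eq = trans (cong (q ++_) (trans (map-++ proj₂ (copied c v) M) (cong (_++ letters M) (letters-copied c v))))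
             (sym (++-assoc q (c ∷ v) (letters M)))

data EndsA : Marked → Set where
  here  : ∀ {m} → EndsA ((m , a) ∷ [])
  there : ∀ {x g} → EndsA g → EndsA (x ∷ g)

endsA : ∀ g {h} → letters g ≡ h ++ [ a ] → EndsA g
endsA [] {[]} ()
endsA [] {_ ∷ _} ()
endsA (_ ∷ []) {[]} refl = here
endsA (_ ∷ _ ∷ _) {[]} ()
endsA (_ ∷ g) {_ ∷ h} e = there (endsA g (∷-injectiveʳ e))

endsA-++ʳ : ∀ x {c g} → EndsA (x ++ c ∷ g) → EndsA (c ∷ g)
endsA-++ʳ [] e = e
endsA-++ʳ (_ ∷ []) (there e) = e
endsA-++ʳ (_ ∷ y ∷ x) (there e) = endsA-++ʳ (y ∷ x) e

-- A phrase begins where `g` begins. Bad phrases are single letters `b`, so skipping them never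
-- passes the final `a` of `g`; the phrase that stops the skipping begins inside `g` and is good.
LZ-starts-good : ∀ {q M} g {r} → LZ q M → M ≡ g ++ r → EndsA g → goods g ≢ 0
LZ-starts-good [] z e₁ () g0
LZ-starts-good ((good , _) ∷ g) z e₁ e ()
LZ-starts-good ((cont , _) ∷ g) [] () e g0
LZ-starts-good ((cont , _) ∷ g) (letter-a z) () e g0
LZ-starts-good ((cont , _) ∷ g) (letter-b z) () e g0
LZ-starts-good ((cont , _) ∷ g) (copy c v f z) () e g0
LZ-starts-good ((bad , _) ∷ g) [] () e g0
LZ-starts-good ((bad , _) ∷ g) (letter-a z) () e g0
LZ-starts-good ((bad , _) ∷ g) (copy c v f z) () e g0
LZ-starts-good ((bad , _) ∷ g) (letter-b z) refl (there e) g0 = LZ-starts-good g z refl e g0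

-- Without a good mark in g, a phrase can only start at a b of g and then is b
-- itself; as g ends in a, all of c·g lies inside one phrase.
no-good⇒factor : ∀ {q M} p {m c} g {r} → LZ q M → M ≡ p ++ (m , c) ∷ g ++ r →
                 EndsA g → goods g ≡ 0 → Factor (c ∷ letters g) (q ++ letters p)
no-good⇒factor [] g [] () e g0
no-good⇒factor (_ ∷ _) g [] () e g0
no-good⇒factor [] g (letter-a z) refl e g0 = ⊥-elim (LZ-starts-good g z refl e g0)
no-good⇒factor [] g (letter-b z) refl e g0 = ⊥-elim (LZ-starts-good g z refl e g0)
no-good⇒factor {q} (_ ∷ p) g (letter-a z) refl e g0 =
  subst (Factor _) (++-assoc q [ a ] (letters p)) (no-good⇒factor p g z refl e g0)
no-good⇒factor {q} (_ ∷ p) g (letter-b z) refl e g0 =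
  subst (Factor _) (++-assoc q [ b ] (letters p)) (no-good⇒factor p g z refl e g0)
no-good⇒factor {q} p {m} {c} g {r} (copy {M = M} d v f z) eq e g0
  with ++-split (copied d v) {zs = p} eq
... | inj₁ (p′ , refl , eq′) =
  subst (Factor _) (trans (++-assoc q (d ∷ v) (letters p′)) (cong (q ++_)
      (trans (cong (_++ letters p′) (sym (letters-copied d v))) (sym (map-++ proj₂ (copied d v) p′)))))
    (no-good⇒factor p′ g z eq′ e g0)
... | inj₂ (x , u , eq₁ , eq₂) with ∷-injective eq₂
... | refl , eq₃ with ++-split u {ys = M} {zs = g} {ws = r} (sym eq₃)
-- The copy ends inside `g`, so the rest of `g` begins with a phrase and contains a good mark. In
-- the other two cases the copy covers `c` and all of `g`, and its source lies in `q`.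
... | inj₁ (y ∷ g′ , refl , eq₄) =
  ⊥-elim (LZ-starts-good (y ∷ g′) z eq₄ (endsA-++ʳ u e) (m+n≡0⇒n≡0 (goods u) (trans (sym (goods-++ u (y ∷ g′))) g0)))
... | inj₁ ([] , refl , _) = factor-++ʳ (letters p)
  (factor-inner (letters p) (c ∷ letters (u ++ [])) [] (subst (λ w → Factor w q) lem f))
  where
  lem : d ∷ v ≡ letters p ++ (c ∷ letters (u ++ [])) ++ []
  lem = trans (sym (letters-copied d v)) (trans (cong letters eq₁) (trans (map-++ proj₂ p (x ∷ u))
        (cong (letters p ++_) (trans (cong (λ w → c ∷ letters w) (sym (++-identityʳ u))) (sym (++-identityʳ _))))))
... | inj₂ (y , u′ , refl , _) = factor-++ʳ (letters p)
  (factor-inner (letters p) (c ∷ letters g) (letters (y ∷ u′)) (subst (λ w → Factor w q) lem f))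
  where
  lem : d ∷ v ≡ letters p ++ (c ∷ letters g) ++ letters (y ∷ u′)
  lem = trans (sym (letters-copied d v)) (trans (cong letters eq₁) (trans (map-++ proj₂ p (x ∷ g ++ y ∷ u′))
        (cong (λ w → letters p ++ c ∷ w) (map-++ proj₂ g (y ∷ u′)))))

letters-split : ∀ M u {v} → letters M ≡ u ++ v →
                ∃[ M₁ ] ∃[ M₂ ] (M ≡ M₁ ++ M₂ × letters M₁ ≡ u × letters M₂ ≡ v)
letters-split M []      e = [] , M , refl , refl , e
letters-split (x ∷ M) (c ∷ u) e with ∷-injective e
... | refl , e′ with letters-split M u e′
... | M₁ , M₂ , refl , refl , e₂ = x ∷ M₁ , M₂ , refl , refl , e₂

-- The continuation `M₂` is arbitrary because a phrase starting in `u` may run past the end of `u`.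
-- Phrases are counted by their starts, so counts over consecutive regions add up.
LB : List Letter → ℕ → Set
LB u k = ∀ {M₁ M₂} → LZ [] (M₁ ++ M₂) → letters M₁ ≡ u → k ≤ goods M₁

-- Without a good mark in the new region `g ++ [ a ]`, one copied phrase would cover the region
-- together with the letter `c` before it. Its source would lie in `e`, because sources do not
-- overlap their copies.
LB-extend : ∀ e c g {k} → LB (e ++ [ c ]) k → ¬ Factor (c ∷ g ++ [ a ]) e →
            LB ((e ++ [ c ]) ++ (g ++ [ a ])) (suc k)
LB-extend e c g lb nf {M₁} {M₂} z eq with letters-split M₁ (e ++ [ c ]) eq
... | N₁ , N₂ , refl , eq₁ , eq₂ with letters-split N₁ e eq₁
... | K , (m , _) ∷ [] , refl , eq₃ , refl = ≤-trans (≤-reflexive (+-comm 1 _))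
  (≤-trans (+-mono-≤ (lb (subst (LZ []) (++-assoc (K ++ _) N₂ M₂) z) eq₁) (n≢0⇒n>0 pos))
           (≤-reflexive (sym (goods-++ (K ++ _) N₂))))
  where
  pos : goods N₂ ≢ 0
  pos g0 = nf (subst₂ (λ x y → Factor (c ∷ x) y) eq₂ eq₃
    (no-good⇒factor K N₂ z (trans (++-assoc (K ++ _) N₂ M₂) (++-assoc K [ m , c ] (N₂ ++ M₂)))
      (endsA N₂ eq₂) g0))

LB-weaken : ∀ {u k} v → LB u k → LB (u ++ v) k
LB-weaken {u} v lb {M₁} {M₂} z eq with letters-split M₁ u eq
... | N₁ , N₂ , refl , eq₁ , _ = ≤-trans (lb (subst (LZ []) (++-assoc N₁ N₂ M₂) z) eq₁)
  (≤-trans (m≤m+n _ _) (≤-reflexive (sym (goods-++ N₁ N₂))))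

LZ-first-a : ∀ {M} → LZ [] M → ∀ {m r} → M ≡ (m , a) ∷ r → m ≡ good
LZ-first-a (letter-a z) refl = refl
LZ-first-a (copy c v f z) refl = refl

LB-a : LB [ a ] 1
LB-a {_ ∷ []} z refl rewrite LZ-first-a z refl = ≤-refl

LB-b : LB [ b ] 0
LB-b _ _ = z≤n

-- Counting good marks

-- stage i is a prefix of F_{i+4} ending in a; stages are the points up to
-- which the good marks can be counted region by region.
stage : ℕ → List Letter
stage i = pal (1 + i) ++ tail (odd i)
  where
  tail : Bool → List Letter
  tail false = b ∷ a ∷ []
  tail true  = [ a ]

-- The count is run with `q` empty for Fibonacci words and with `q` equal to `[ b ]` for the words
-- bPa. The forbidden factors used along the stages begin with `a`, hence cannot begin in such a
-- `q`.
Skippable : List Letter → Set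
Skippable q = ∀ {u w} → Factor (a ∷ u) (q ++ w) → Factor (a ∷ u) w

pal-factor : ∀ {u} i → Factor u (pal (1 + i)) → Factor u (pal (2 + i))
pal-factor {u} i f = subst (Factor u) (sym (pal-right i)) (factor-++ʳ _ f)

-- By `pal-right` the region added to an even stage is `pal i ++ [ a ]`, and with the `a` before it
-- it forms aPa. The region added to an odd stage is `b ∷ pal i` followed by `ba`, and with the `a`
-- before it it contains bPb. Here P is `pal i`, and `¬singular` forbids both as factors of the
-- earlier text.
LB-stage-suc : ∀ q → Skippable q → ∀ i {k} → LB (q ++ stage i) k → LB (q ++ stage (suc i)) (suc k)
LB-stage-suc q hq i {k} lb with odd i in eq
... | false = subst (λ w → LB w (suc k)) eq₂ (LB-extend (q ++ pal (1 + i) ++ [ b ]) a (pal i)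
                (subst (λ w → LB w k) eq₁ lb) nf)
  where
  nf : ¬ Factor (a ∷ pal i ++ [ a ]) (q ++ pal (1 + i) ++ [ b ])
  nf f = ¬singular a i (pal-factor i (factor-init {u = a ∷ pal i} (λ ()) (hq f)))
  eq₁ : q ++ pal (1 + i) ++ b ∷ a ∷ [] ≡ (q ++ pal (1 + i) ++ [ b ]) ++ [ a ]
  eq₁ = sym (trans (++-assoc q _ [ a ]) (cong (q ++_) (++-assoc (pal (1 + i)) [ b ] [ a ])))
  eq₂ : ((q ++ pal (1 + i) ++ [ b ]) ++ [ a ]) ++ pal i ++ [ a ] ≡ q ++ pal (2 + i) ++ [ a ]
  eq₂ = trans (cong (_++ pal i ++ [ a ]) (sym eq₁)) (trans (++-assoc q _ _)
        (cong (q ++_) (trans (++-assoc (pal (1 + i)) (b ∷ a ∷ []) _)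
          (sym (trans (cong (_++ [ a ]) (trans (pal-right i) (cong (λ o → pal (1 + i) ++ ends (not o) ++ pal i) eq)))
                      (++-assoc (pal (1 + i)) _ [ a ]))))))
... | true = subst (λ w → LB w (suc k)) eq₂ (LB-extend (q ++ pal (1 + i)) a (b ∷ pal i ++ [ b ])
                (subst (λ w → LB w k) (sym (++-assoc q _ [ a ])) lb) nf)
  where
  nf : ¬ Factor (a ∷ (b ∷ pal i ++ [ b ]) ++ [ a ]) (q ++ pal (1 + i))
  nf f = ¬singular b i (pal-factor i (factor-inner [ a ] (b ∷ pal i ++ [ b ]) [ a ] (hq f)))
  eq₂ : ((q ++ pal (1 + i)) ++ [ a ]) ++ (b ∷ pal i ++ [ b ]) ++ [ a ] ≡ q ++ pal (2 + i) ++ b ∷ a ∷ []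
  eq₂ = trans (cong (_++ (b ∷ pal i ++ [ b ]) ++ [ a ]) (++-assoc q _ [ a ])) (trans (++-assoc q _ _)
        (cong (q ++_) (trans (++-assoc (pal (1 + i)) [ a ] _)
          (sym (trans (cong (_++ b ∷ a ∷ []) (trans (pal-right i) (cong (λ o → pal (1 + i) ++ ends (not o) ++ pal i) eq)))
                      (trans (++-assoc (pal (1 + i)) _ _) (cong (λ w → pal (1 + i) ++ a ∷ b ∷ w) (sym (++-assoc (pal i) [ b ] [ a ])))))))))

LB-stage : ∀ q → Skippable q → LB (q ++ stage 0) 2 → ∀ i → LB (q ++ stage i) (2 + i)
LB-stage q hq lb zero    = lb
LB-stage q hq lb (suc i) = LB-stage-suc q hq i (LB-stage q hq lb i)

¬factor-letter : ∀ {c d e u} → ¬ Factor (c ∷ d ∷ u) [ e ]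
¬factor-letter ([] , _ , ())
¬factor-letter (_ ∷ [] , _ , ())
¬factor-letter (_ ∷ _ ∷ _ , _ , ())

skippable-b : Skippable [ b ]
skippable-b = factor-tail (λ ())

LB-stage-[] : ∀ i → LB (stage i) (2 + i)
LB-stage-[] = LB-stage [] (λ f → f) (LB-extend [ a ] b [] (LB-weaken [ b ] LB-a) ¬factor-letter)

LB-stage-b : ∀ i → LB (b ∷ stage i) (2 + i)
LB-stage-b = LB-stage [ b ] skippable-b
  (LB-extend [ b ] a [ b ] (LB-extend [] b [] LB-b ¬factor-empty) ¬factor-letter)

LB-fib : ∀ i → LB (pal (1 + i) ++ ends (odd (1 + i))) (2 + i)
LB-fib i with odd i | LB-stage-[] i
... | false | lb = lb
... | true  | lb = subst (λ w → LB w (2 + i)) (++-assoc (pal (1 + i)) [ a ] [ b ]) (LB-weaken [ b ] lb)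

pal-suffix : ∀ i → odd i ≡ false → ∃[ r ] pal (1 + i) ≡ r ++ a ∷ pal i
pal-suffix zero    e = [] , refl
pal-suffix (suc k) e = pal k ++ [ b ] , trans (pal-left k)
  (trans (cong (λ o → pal k ++ ends o ++ pal (1 + k)) (lem (odd k) e)) (sym (++-assoc (pal k) [ b ] _)))
  where
  lem : ∀ o → not o ≡ false → o ≡ true
  lem true _ = refl

-- For even `i` the word is a stage preceded by `b`. For odd `i` the next stage would end in `ba`
-- where the word has only `a`, so the last region is shortened. The factor to exclude is then `ab`
-- followed by `pal i` and `a`; by `pal-suffix` it still contains a singular word aPa, one level
-- lower.
LB-bpa : ∀ i → LB (b ∷ pal (2 + i) ++ [ a ]) (3 + i)
LB-bpa i with odd i in eq | LB-stage-b i | LB-stage-b (suc i)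
... | false | _  | lb = lb
LB-bpa (suc i) | true | lb | _ = subst (λ w → LB w (4 + i)) eq₂
    (LB-extend (b ∷ pal (2 + i)) a (b ∷ pal (1 + i)) lb nf)
  where
  even : odd i ≡ false
  even = lem (odd i) eq
    where
    lem : ∀ o → not o ≡ true → o ≡ false
    lem false _ = refl
  nf : ¬ Factor (a ∷ (b ∷ pal (1 + i)) ++ [ a ]) (b ∷ pal (2 + i))
  nf f with pal-suffix i even
  ... | r , s = ¬singular a i (factor-inner (a ∷ b ∷ r) (a ∷ pal i ++ [ a ]) []
        (subst (λ w → Factor w (pal (2 + i)))
          (cong (λ w → a ∷ b ∷ w) (trans (cong (_++ [ a ]) s) (trans (++-assoc r _ [ a ])
             (cong (r ++_) (sym (++-identityʳ _)))))) (skippable-b f)))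
  eq₂ : ((b ∷ pal (2 + i)) ++ [ a ]) ++ (b ∷ pal (1 + i)) ++ [ a ] ≡ b ∷ pal (3 + i) ++ [ a ]
  eq₂ = cong (b ∷_) (trans (++-assoc (pal (2 + i)) [ a ] _) (sym (trans
          (cong (_++ [ a ]) (trans (pal-right (suc i)) (cong (λ o → pal (2 + i) ++ ends (not o) ++ pal (1 + i)) eq)))
          (++-assoc (pal (2 + i)) _ [ a ]))))

-- Partial parse trees

-- RD rule term Fr i u: u is derived from i, stopping at the non-terminals that
-- term declares to be letters and expanding only non-terminals in Fr.
data RD {N} (rule : Fin N → Rule N) (term : Fin N → Maybe Letter) (Fr : Fin N → Set) :
        Fin N → List Letter → Set where
  terminal : ∀ {i c} → term i ≡ just c → RD rule term Fr i [ c ]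
  inner    : ∀ {i j k u v} → term i ≡ nothing → Fr i → rule i ≡ node j k →
             RD rule term Fr j u → RD rule term Fr k v → RD rule term Fr i (u ++ v)

just≢nothing : ∀ {A : Set} {x : A} {m : Maybe A} → m ≡ just x → m ≡ nothing → ⊥
just≢nothing refl ()

node-injective : ∀ {n} {j k j′ k′ : Fin n} → node j k ≡ node j′ k′ → j ≡ j′ × k ≡ k′
node-injective refl = refl , refl

module _ {N} {rule : Fin N → Rule N} {term : Fin N → Maybe Letter} where

  RD-functional : ∀ {Fr Fr′ i u v} → RD rule term Fr i u → RD rule term Fr′ i v → u ≡ v
  RD-functional (terminal e) (terminal e′) = cong [_] (just-injective (trans (sym e) e′))
  RD-functional (terminal e) (inner e′ _ _ _ _) = ⊥-elim (just≢nothing e e′)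
  RD-functional (inner e _ _ _ _) (terminal e′) = ⊥-elim (just≢nothing e′ e)
  RD-functional (inner _ _ r d₁ d₂) (inner _ _ r′ d₁′ d₂′) with node-injective (trans (sym r) r′)
  ... | refl , refl = cong₂ _++_ (RD-functional d₁ d₁′) (RD-functional d₂ d₂′)

  RD-weaken : ∀ {Fr Fr′ : Fin N → Set} {i u} → (∀ {i} → Fr i → Fr′ i) →
              RD rule term Fr i u → RD rule term Fr′ i u
  RD-weaken h (terminal e)          = terminal e
  RD-weaken h (inner e f r d₁ d₂) = inner e (h f) r (RD-weaken h d₁) (RD-weaken h d₂)

  RD-nonempty : ∀ {Fr i u} → RD rule term Fr i u → 1 ≤ length u
  RD-nonempty (terminal _) = s≤s z≤n
  RD-nonempty (inner {u = u} _ _ _ d _) = ≤-trans (RD-nonempty d) (length-++-≤ˡ u)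

  RD-inner-length : ∀ {Fr i u} → RD rule term Fr i u → term i ≡ nothing → 2 ≤ length u
  RD-inner-length (terminal e) e′ = ⊥-elim (just≢nothing e e′)
  RD-inner-length (inner {u = u} _ _ _ d₁ d₂) _ =
    ≤-trans (+-mono-≤ (RD-nonempty d₁) (RD-nonempty d₂)) (≤-reflexive (sym (length-++ u)))

RD-inner : ∀ {N} {rule : Fin N → Rule N} {term Fr i w} → RD rule term Fr i w → 2 ≤ length w → term i ≡ nothing
RD-inner (terminal _) (s≤s ())
RD-inner (inner e _ _ _ _) _ = e

b-count : Maybe Letter → ℕ
b-count (just b) = 1
b-count _        = 0

b-children : ∀ {N} → (Fin N → Maybe Letter) → Rule N → ℕ
b-children term (leaf _)   = 0
b-children term (node j k) = b-count (term j) + b-count (term k)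

uses : ∀ {N} → (Fin N → Rule N) → (Fin N → Maybe Letter) → List (Fin N) → ℕ
uses rule term []      = 0
uses rule term (i ∷ S) = b-children term (rule i) + uses rule term S

Descending : ∀ {N} → (Fin N → Rule N) → Set
Descending rule = ∀ {i j k} → rule i ≡ node j k → toℕ j < toℕ i × toℕ k < toℕ i

-- One left-to-right traversal of the derivation tree that expands each
-- non-terminal only once: S lists those expanded before, q is the text read
-- before, and a non-terminal met again contributes one copied phrase.
module PartialParse {N} (rule : Fin N → Rule N) (term : Fin N → Maybe Letter)
                    (desc : Descending rule) (Fr : Fin N → Set) where

  open import Data.List.Membership.DecPropositional (_≟_ {N}) using (_∈?_)

  Inv : List (Fin N) → List Letter → Set
  Inv S q = ∀ {i} → i ∈ S → ∃[ u ] (RD rule term (_∈ S) i u × Factor u q)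

  -- `bounded` guarantees that visiting the children of `i` does not expand `i`, so adding `i`
  -- afterwards keeps the list duplicate-free. In `phrases`, a letter or a repeated non-terminal
  -- yields one phrase, while an expansion joins two visits and spends one rule. In `b-uses`, an
  -- occurrence of `b` is charged to the rule that has it as a child; the last summand is the charge
  -- left to the parent of `i`.
  record Visit (S : List (Fin N)) (q : List Letter) (i : Fin N) (u : List Letter) : Set where
    constructor visited
    field
      S′      : List (Fin N)
      M       : Marked
      parse   : LZ q M
      spells  : letters M ≡ u
      derives : RD rule term (_∈ S′) i u
      inv     : Inv S′ (q ++ u)
      unique  : Unique S′
      free    : All Fr S′
      grows   : ∀ {x} → x ∈ S → x ∈ S′
      bounded : ∀ {x} → x ∈ S′ → x ∈ S ⊎ toℕ x ≤ toℕ i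
      phrases : goods M + bads M + length S ≡ suc (length S′)
      b-uses  : bads M + uses rule term S ≡ uses rule term S′ + b-count (term i)

  inv-weaken : ∀ {S q} u → Inv S q → Inv S (q ++ u)
  inv-weaken u inv m with inv m
  ... | v , d , f = v , d , factor-++ʳ u f

  visit : ∀ {S q i u} → RD rule term Fr i u → Inv S q → Unique S → All Fr S → Visit S q i u
  visit {S} {i = i} (terminal {c = a} e) inv uniq fr =
    visited S _ (letter-a []) refl (terminal e) (inv-weaken [ a ] inv) uniq fr (λ m → m) inj₁ refl
            (trans (sym (+-identityʳ _)) (cong (λ t → uses rule term S + b-count t) (sym e)))
  visit {S} {i = i} (terminal {c = b} e) inv uniq fr =
    visited S _ (letter-b []) refl (terminal e) (inv-weaken [ b ] inv) uniq fr (λ m → m) inj₁ refl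
            (trans (+-comm 1 _) (cong (λ t → uses rule term S + b-count t) (sym e)))
  visit {S} {q} {i} d@(inner e fi r d₁ d₂) inv uniq fr with i ∈? S
  ... | yes m with inv m
  ...   | u , d′ , f with RD-functional d d′
  ...     | w≡u = subst (Visit S q i) (sym w≡u) (seen u d′ f)
    where
    seen : ∀ u → RD rule term (_∈ S) i u → Factor u q → Visit S q i u
    seen [] d′ f = ⊥-elim (<-irrefl refl (RD-nonempty d′))
    seen (c ∷ v) d′ f = visited S (copied c v)
      (subst (LZ q) (++-identityʳ _) (copy c v f [])) (letters-copied c v) d′ (inv-weaken (c ∷ v) inv) uniq fr
      (λ m → m) inj₁
      (cong₂ (λ x y → x + y + length S) (goods-copied c v) (bads-copied c v))
      (trans (cong (_+ uses rule term S) (bads-copied c v))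
        (trans (sym (+-identityʳ _)) (cong (λ t → uses rule term S + b-count t) (sym e))))
  visit {S} {q} {i} d@(inner {j = j} {k} {u} {v} e fi r d₁ d₂) inv uniq fr | no i∉S
    with visit d₁ inv uniq fr
  ... | visited S₁ M₁ p₁ s₁ t₁ inv₁ uniq₁ fr₁ g₁ b₁ ph₁ us₁
    with visit d₂ inv₁ uniq₁ fr₁
  ... | visited S₂ M₂ p₂ s₂ t₂ inv₂ uniq₂ fr₂ g₂ b₂ ph₂ us₂ =
    visited (i ∷ S₂) (M₁ ++ M₂)
      (LZ-++ p₁ (subst (λ w → LZ (q ++ w) M₂) (sym s₁) p₂))
      (trans (map-++ proj₂ M₁ M₂) (cong₂ _++_ s₁ s₂))
      tree inv′ (All.tabulate (λ m eq → i∉S₂ (subst (_∈ S₂) (sym eq) m)) ∷ uniq₂) (fi ∷ fr₂)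
      (λ m → there (g₂ (g₁ m))) bound phr use
    where
    j<i : toℕ j < toℕ i
    j<i = proj₁ (desc r)
    k<i : toℕ k < toℕ i
    k<i = proj₂ (desc r)
    below : ∀ {x} → x ∈ S₂ → x ∈ S ⊎ toℕ x < toℕ i
    below m with b₂ m
    ... | inj₂ x≤k = inj₂ (≤-<-trans x≤k k<i)
    ... | inj₁ m₁ with b₁ m₁
    ...   | inj₁ m₀  = inj₁ m₀
    ...   | inj₂ x≤j = inj₂ (≤-<-trans x≤j j<i)
    i∉S₂ : ¬ (i ∈ S₂)
    i∉S₂ m with below m
    ... | inj₁ m₀  = i∉S m₀
    ... | inj₂ i<i = <-irrefl refl i<i
    bound : ∀ {x} → x ∈ i ∷ S₂ → x ∈ S ⊎ toℕ x ≤ toℕ i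
    bound (here refl) = inj₂ ≤-refl
    bound (there m) with below m
    ... | inj₁ m₀  = inj₁ m₀
    ... | inj₂ x<i = inj₂ (<⇒≤ x<i)
    tree : RD rule term (_∈ i ∷ S₂) i (u ++ v)
    tree = inner e (here refl) r (RD-weaken (λ m → there (g₂ m)) t₁) (RD-weaken there t₂)
    inv′ : Inv (i ∷ S₂) (q ++ u ++ v)
    inv′ (here refl) = u ++ v , tree , (q , [] , cong (q ++_) (sym (++-identityʳ _)))
    inv′ (there m) with inv₂ m
    ... | w , d′ , f = w , RD-weaken there d′ , subst (Factor w) (++-assoc q u v) f
    phr : goods (M₁ ++ M₂) + bads (M₁ ++ M₂) + length S ≡ suc (suc (length S₂))
    phr = begin
      goods (M₁ ++ M₂) + bads (M₁ ++ M₂) + length S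
        ≡⟨ cong₂ (λ x y → x + y + length S) (goods-++ M₁ M₂) (bads-++ M₁ M₂) ⟩
      goods M₁ + goods M₂ + (bads M₁ + bads M₂) + length S
        ≡⟨ swap (goods M₁) (goods M₂) (bads M₁) (bads M₂) (length S) ⟩
      goods M₂ + bads M₂ + (goods M₁ + bads M₁ + length S)
        ≡⟨ cong (goods M₂ + bads M₂ +_) ph₁ ⟩
      goods M₂ + bads M₂ + suc (length S₁)
        ≡⟨ +-suc _ (length S₁) ⟩
      suc (goods M₂ + bads M₂ + length S₁)
        ≡⟨ cong suc ph₂ ⟩
      suc (suc (length S₂)) ∎
      where
      swap : ∀ g₁ g₂ b₁ b₂ s → g₁ + g₂ + (b₁ + b₂) + s ≡ g₂ + b₂ + (g₁ + b₁ + s)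
      swap = solve-∀
    use : bads (M₁ ++ M₂) + uses rule term S ≡ b-children term (rule i) + uses rule term S₂ + b-count (term i)
    use = begin
      bads (M₁ ++ M₂) + uses rule term S
        ≡⟨ cong (_+ uses rule term S) (trans (bads-++ M₁ M₂) (+-comm (bads M₁) _)) ⟩
      bads M₂ + bads M₁ + uses rule term S
        ≡⟨ +-assoc (bads M₂) (bads M₁) _ ⟩
      bads M₂ + (bads M₁ + uses rule term S)
        ≡⟨ cong (bads M₂ +_) us₁ ⟩
      bads M₂ + (uses rule term S₁ + b-count (term j))
        ≡⟨ +-assoc (bads M₂) _ _ ⟨
      bads M₂ + uses rule term S₁ + b-count (term j)
        ≡⟨ cong (_+ b-count (term j)) us₂ ⟩
      uses rule term S₂ + b-count (term k) + b-count (term j)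
        ≡⟨ swap (uses rule term S₂) (b-count (term k)) (b-count (term j)) ⟩
      b-count (term j) + b-count (term k) + uses rule term S₂ + 0
        ≡⟨ cong₂ (λ x y → b-children term x + uses rule term S₂ + b-count y) r e ⟨
      b-children term (rule i) + uses rule term S₂ + b-count (term i) ∎
      where
      swap : ∀ s x y → s + x + y ≡ y + x + s + 0
      swap = solve-∀

-- `tight` combines the two balances of `Visit` for a traversal starting from nothing: bad phrases
-- are exactly the uses of `b`, and all phrases together number one more than `S`.
record Expansion {N} (rule : Fin N → Rule N) (term : Fin N → Maybe Letter)
                 (Fr : Fin N → Set) (i : Fin N) (w : List Letter) : Set where
  constructor expansion
  field
    S       : List (Fin N)
    derives : RD rule term (_∈ S) i w
    unique  : Unique S
    free    : All Fr S
    tight   : ∀ {k} → LB w k → k + uses rule term S ≤ suc (length S)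

expand : ∀ {N} {rule : Fin N → Rule N} {term Fr i w} → Descending rule → term i ≡ nothing →
         RD rule term Fr i w → Expansion rule term Fr i w
expand {rule = rule} {term} {Fr} {i} {w} desc e d
  with PartialParse.visit rule term desc Fr {[]} {[]} d (λ ()) [] []
... | PartialParse.visited S M z sp t _ un fr _ _ ph us = expansion S t un fr tight
  where
  tight : ∀ {k} → LB w k → k + uses rule term S ≤ suc (length S)
  tight lb = ≤-trans
    (+-mono-≤ (lb {M} {[]} (subst (LZ []) (sym (++-identityʳ M)) z) sp)
              (≤-reflexive (trans (sym (+-identityʳ _)) (trans (cong (λ t → uses rule term S + b-count t) (sym e))
                 (trans (sym us) (+-identityʳ _))))))
    (≤-reflexive (trans (sym (+-identityʳ _)) ph))

-- The only rule using b

record Terminals {N} (term : Fin N → Maybe Letter) (A B : Fin N) : Set where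
  field
    at-a   : term A ≡ just a
    at-b   : term B ≡ just b
    only-a : ∀ {i} → term i ≡ just a → i ≡ A
    only-b : ∀ {i} → term i ≡ just b → i ≡ B

term[_,_] : ∀ {N} → Fin N → Fin N → Fin N → Maybe Letter
term[ A , B ] i with i ≟ A | i ≟ B
... | yes _ | _     = just a
... | no _  | yes _ = just b
... | no _  | no _  = nothing

term-terminals : ∀ {N} {A B : Fin N} → A ≢ B → Terminals term[ A , B ] A B
term-terminals {A = A} {B} A≢B = record { at-a = at-a ; at-b = at-b ; only-a = only-a ; only-b = only-b }
  where
  at-a : term[ A , B ] A ≡ just a
  at-a with A ≟ A | A ≟ B
  ... | yes _ | _ = refl
  ... | no n | _ = ⊥-elim (n refl)
  at-b : term[ A , B ] B ≡ just b
  at-b with B ≟ A | B ≟ B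
  ... | yes e | _ = ⊥-elim (A≢B (sym e))
  ... | no _ | yes _ = refl
  ... | no _ | no n = ⊥-elim (n refl)
  only-a : ∀ {i} → term[ A , B ] i ≡ just a → i ≡ A
  only-a {i} e with i ≟ A | i ≟ B
  ... | yes p | _ = p
  only-a () | no _ | yes _
  only-a () | no _ | no _
  only-b : ∀ {i} → term[ A , B ] i ≡ just b → i ≡ B
  only-b {i} e with i ≟ A | i ≟ B
  only-b () | yes _ | _
  ... | no _ | yes p = p
  only-b () | no _ | no _

term-nothing : ∀ {N} {A B i : Fin N} → i ≢ A → i ≢ B → term[ A , B ] i ≡ nothing
term-nothing {A = A} {B} {i} i≢A i≢B with i ≟ A | i ≟ B
... | yes p | _     = ⊥-elim (i≢A p)
... | no _  | yes p = ⊥-elim (i≢B p)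
... | no _  | no _  = refl

module _ {N} {rule : Fin N → Rule N} {term : Fin N → Maybe Letter} where

  uses-∈ : ∀ {S i} → i ∈ S → b-children term (rule i) ≤ uses rule term S
  uses-∈ (here refl) = m≤m+n _ _
  uses-∈ (there m)   = ≤-trans (uses-∈ m) (m≤n+m _ _)

  uses-∈₂ : ∀ {S i j} → i ≢ j → i ∈ S → j ∈ S →
            b-children term (rule i) + b-children term (rule j) ≤ uses rule term S
  uses-∈₂ i≢j (here refl) (here refl) = ⊥-elim (i≢j refl)
  uses-∈₂ i≢j (here refl) (there n)   = +-monoʳ-≤ _ (uses-∈ n)
  uses-∈₂ {j = j} i≢j (there m) (here refl) =
    ≤-trans (≤-reflexive (+-comm _ (b-children term (rule j)))) (+-monoʳ-≤ _ (uses-∈ m))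
  uses-∈₂ i≢j (there m) (there n)     = ≤-trans (uses-∈₂ i≢j m n) (m≤n+m _ _)

  -- The index bound `X≤i` serves to distinguish a user found below a child of some rule from that
  -- rule itself.
  record BUser (S : List (Fin N)) (i : Fin N) : Set where
    constructor b-user
    field
      {X j k} : Fin N
      {u v}   : List Letter
      X∈S     : X ∈ S
      X≤i     : toℕ X ≤ toℕ i
      X-inner : term X ≡ nothing
      ruleX   : rule X ≡ node j k
      left    : RD rule term (_∈ S) j u
      right   : RD rule term (_∈ S) k v
      b-child : term j ≡ just b ⊎ term k ≡ just b

  b-child-used : ∀ {X j k} → rule X ≡ node j k → term j ≡ just b ⊎ term k ≡ just b →
                 1 ≤ b-children term (rule X)
  b-child-used {j = j} {k} r c rewrite r with c
  ... | inj₁ e rewrite e = s≤s z≤n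
  ... | inj₂ e rewrite e = m≤n+m 1 (b-count (term j))

  find-b-user : Descending rule → ∀ {S i u} → RD rule term (_∈ S) i u → term i ≡ nothing →
                1 ≤ occ b u → BUser S i
  find-b-user desc (terminal e) e′ _ = ⊥-elim (just≢nothing e e′)
  find-b-user desc {S} {i} (inner {j = j} {k} {u} {v} e m r d₁ d₂) _ pos
    with term j in tj | term k in tk | 1 ≤? occ b u | d₁ | d₂
  ... | just b  | _       | _     | _ | _ = b-user m ≤-refl e r d₁ d₂ (inj₁ tj)
  ... | _       | just b  | _     | _ | _ = b-user m ≤-refl e r d₁ d₂ (inj₂ tk)
  ... | nothing | _       | yes p | _ | _ with find-b-user desc d₁ tj p
  ...   | b-user x≤ y z w l q c = b-user x≤ (≤-trans y (<⇒≤ (proj₁ (desc r)))) z w l q c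
  find-b-user desc (inner {u = u} {v} e m r d₁ d₂) _ pos | _ | nothing | no p | _ | _
    with find-b-user desc d₂ tk (subst (1 ≤_) (trans (occ-++ b u v) (cong (_+ occ b v) (n≤0⇒n≡0 (≤-pred (≰⇒> p))))) pos)
  ...   | b-user x≤ y z w l q c = b-user x≤ (≤-trans y (<⇒≤ (proj₂ (desc r)))) z w l q c
  find-b-user desc (inner e m r d₁ d₂) _ pos | just a | _ | yes p | terminal e₁ | _
    with just-injective (trans (sym tj) e₁)
  ... | refl = ⊥-elim (<-irrefl refl p)
  find-b-user desc (inner e m r d₁ d₂) _ pos | just a | _ | yes p | inner e₁ _ _ _ _ | _ =
    ⊥-elim (just≢nothing tj e₁)
  find-b-user desc (inner {u = u} {v} e m r d₁ d₂) _ pos | _ | just a | no p | _ | d₂′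
    with subst (1 ≤_) (trans (occ-++ b u v) (cong (_+ occ b v) (n≤0⇒n≡0 (≤-pred (≰⇒> p))))) pos | d₂′
  ... | pos′ | inner e₁ _ _ _ _ = ⊥-elim (just≢nothing tk e₁)
  ... | pos′ | terminal e₁ with just-injective (trans (sym tk) e₁)
  ...   | refl = ⊥-elim (<-irrefl refl pos′)

  -- The unique rule that uses B has A as its other child: otherwise that child
  -- spells at least two letters a, so there would be two a's for every b.
  record Pairing (S : List (Fin N)) (A B : Fin N) : Set where
    field
      X       : Fin N
      X∈S     : X ∈ S
      X-inner : term X ≡ nothing
      ruleX   : rule X ≡ node A B ⊎ rule X ≡ node B A
      only    : ∀ {i j k} → i ∈ S → i ≢ X → rule i ≡ node j k → j ≢ B × k ≢ B

  pairing : Descending rule → ∀ {A B S i w} → Terminals term A B → uses rule term S ≤ 1 →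
            RD rule term (_∈ S) i w → term i ≡ nothing → 1 ≤ occ b w → occ a w < occ b w + occ b w → Pairing S A B
  pairing desc {A} {B} {S} {i} {w} T us d ti pos lt = conclude
    where
    open Terminals T
    open BUser (find-b-user desc d ti pos)
    only-X : ∀ {i j k} → i ∈ S → i ≢ X → rule i ≡ node j k → j ≢ B × k ≢ B
    only-X {i} {j} {k} m i≢X r = (λ { refl → no-use (inj₁ at-b) }) , (λ { refl → no-use (inj₂ at-b) })
      where
      no-use : ¬ (term j ≡ just b ⊎ term k ≡ just b)
      no-use c = <-irrefl refl (≤-trans (+-mono-≤ (b-child-used r c) (b-child-used ruleX b-child))
                                        (≤-trans (uses-∈₂ i≢X m X∈S) us))
    module Other (U : Fin N) {x : List Letter} (dU : RD rule term (_∈ S) U x) (U<X : toℕ U < toℕ X) (U≢B : U ≢ B)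
                 (word : occ a (u ++ v) ≡ occ a x × occ b (u ++ v) ≡ suc (occ b x)) where
      -- If `U` spelled a power of `a` of length at least two, `X` would have at least two letters
      -- `a` for its one `b`. Every node other than `B` would inherit this ratio, since `b` enters
      -- only through `X`.
      ratio : term U ≡ nothing → occ b x ≡ 0 → ∀ {i y} → RD rule term (_∈ S) i y → i ≢ B → occ b y + occ b y ≤ occ a y
      ratio tU b0 (terminal {c = a} e) i≢B = z≤n
      ratio tU b0 (terminal {c = b} e) i≢B = ⊥-elim (i≢B (only-b e))
      ratio tU b0 {i} d@(inner {u = y} {z} e m r d₁ d₂) i≢B with i ≟ X
      ... | yes refl = subst (λ w → occ b w + occ b w ≤ occ a w)
              (RD-functional (inner X-inner X∈S ruleX left right) d)
              (subst₂ (λ n k → n + n ≤ k) (sym (trans (proj₂ word) (cong suc b0))) (sym (proj₁ word))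
                (subst (2 ≤_) (all-a x b0) (RD-inner-length dU tU)))
        where
        all-a : ∀ x → occ b x ≡ 0 → length x ≡ occ a x
        all-a []      _ = refl
        all-a (a ∷ x) e = cong suc (all-a x e)
      ... | no i≢X = subst₂ (λ n k → n + n ≤ k) (sym (occ-++ b y z)) (sym (occ-++ a y z))
              (≤-trans (≤-reflexive (swap (occ b y) (occ b z)))
                (+-mono-≤ (ratio tU b0 d₁ (proj₁ (only-X m i≢X r))) (ratio tU b0 d₂ (proj₂ (only-X m i≢X r)))))
        where
        swap : ∀ m n → m + n + (m + n) ≡ m + m + (n + n)
        swap = solve-∀
      U≡A : U ≡ A
      U≡A with term U in tU
      ... | just a = only-a tU
      ... | just b = ⊥-elim (U≢B (only-b tU))
      ... | nothing with 1 ≤? occ b x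
      ...   | no p = ⊥-elim (<⇒≱ lt (ratio tU (n≤0⇒n≡0 (≤-pred (≰⇒> p))) d
                       (λ { refl → just≢nothing at-b ti })))
      -- A `b` below `U` would be used by a rule with a smaller index than `X`, hence a second time.
      ...   | yes p with find-b-user desc dU tU p
      ...     | b-user {X = Y} Y∈S Y≤U _ ruleY _ _ c =
        ⊥-elim (<-irrefl refl (≤-trans (+-mono-≤ (b-child-used ruleY c) (b-child-used ruleX b-child))
          (≤-trans (uses-∈₂ (λ { refl → <-irrefl refl (≤-<-trans Y≤U U<X) }) Y∈S X∈S) us)))
    not-both : term j ≡ just b → term k ≡ just b → ⊥
    not-both e₁ e₂ = <-irrefl refl (≤-trans (two j k ruleX e₁ e₂) (≤-trans (uses-∈ X∈S) us))
      where
      two : ∀ j k → rule X ≡ node j k → term j ≡ just b → term k ≡ just b → 2 ≤ b-children term (rule X)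
      two j k r e₁ e₂ rewrite r | e₁ | e₂ = ≤-refl
    is-b : ∀ {Fr i y} → RD rule term Fr i y → term i ≡ just b → y ≡ [ b ]
    is-b d e = RD-functional d (terminal {Fr = _∈ S} e)
    conclude : Pairing S A B
    conclude with b-child
    ... | inj₁ tj = record { X = X ; X∈S = X∈S ; X-inner = X-inner ; only = only-X
                           ; ruleX = inj₂ (trans ruleX (cong₂ node (only-b tj) k≡A)) }
      where
      k≡A : k ≡ A
      k≡A = Other.U≡A k right (proj₂ (desc ruleX)) (λ { refl → not-both tj at-b })
              (subst (λ y → occ a (y ++ v) ≡ occ a v × occ b (y ++ v) ≡ suc (occ b v)) (sym (is-b left tj)) (refl , refl))
    ... | inj₂ tk = record { X = X ; X∈S = X∈S ; X-inner = X-inner ; only = only-X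
                           ; ruleX = inj₁ (trans ruleX (cong₂ node j≡A (only-b tk))) }
      where
      j≡A : j ≡ A
      j≡A = Other.U≡A j left (proj₁ (desc ruleX)) (λ { refl → not-both at-b tk })
              (subst (λ y → occ a (u ++ y) ≡ occ a u × occ b (u ++ y) ≡ suc (occ b u)) (sym (is-b right tk))
                ( trans (occ-++ a u [ b ]) (+-identityʳ _)
                , trans (occ-++ b u [ b ]) (+-comm (occ b u) 1)))

  -- Outside `B` itself, every `b` of the tree hangs below `X`. So the tree can be cut at `X` and
  -- `A`, and reading `X` as the new `a` and `A` as the new `b` undoes `ψ`. The expansion no longer
  -- needs `X`, which leaves one rule fewer for the next level.
  desubstitute : ∀ {A B S} (ψ : List Letter → List Letter) → (∀ x y → ψ (x ++ y) ≡ ψ x ++ ψ y) → ψ [ b ] ≡ [ a ] →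
    Terminals term A B → (P : Pairing S A B) → (let X = Pairing.X P) → (∀ {u} → RD rule term (_∈ S) X u → u ≡ ψ [ a ]) →
    ∀ {i u} → RD rule term (_∈ S) i u → i ≢ B →
    ∃[ v ] (u ≡ ψ v × RD rule term[ X , A ] (λ i → i ∈ S × i ≢ X) i v)
  desubstitute {A} {B} {S} ψ ψ-++ ψ-b T P X-word = go
    where
    open Terminals T
    open Pairing P
    X≢A : X ≢ A
    X≢A X≡A = just≢nothing at-a (subst (λ i → term i ≡ nothing) X≡A X-inner)
    T′ : Terminals term[ X , A ] X A
    T′ = term-terminals X≢A
    go : ∀ {i u} → RD rule term (_∈ S) i u → i ≢ B →
         ∃[ v ] (u ≡ ψ v × RD rule term[ X , A ] (λ i → i ∈ S × i ≢ X) i v)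
    go (terminal {c = a} e) i≢B with only-a e
    ... | refl = [ b ] , sym ψ-b , terminal (Terminals.at-b T′)
    go (terminal {c = b} e) i≢B = ⊥-elim (i≢B (only-b e))
    go {i} d@(inner e m r d₁ d₂) i≢B with i ≟ X
    ... | yes refl = [ a ] , X-word d , terminal (Terminals.at-a T′)
    ... | no i≢X with go d₁ (proj₁ (only m i≢X r)) | go d₂ (proj₂ (only m i≢X r))
    ...   | v₁ , refl , t₁ | v₂ , refl , t₂ = v₁ ++ v₂ , sym (ψ-++ v₁ v₂) ,
      inner (term-nothing i≢X (λ { refl → just≢nothing at-a e })) (m , i≢X) r t₁ t₂

-- Reading a grammar from right to left

mirror : ∀ {n} → Rule n → Rule n
mirror (leaf c)   = leaf c
mirror (node j k) = node k j

module _ {N} (rule : Fin N → Rule N) where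

  mirrored : Fin N → Rule N
  mirrored i = mirror (rule i)

  mirrored-rule : ∀ {i j k} → rule i ≡ node j k → mirrored i ≡ node k j
  mirrored-rule = cong mirror

  mirrored-rule⁻¹ : ∀ {i j k} → mirrored i ≡ node j k → rule i ≡ node k j
  mirrored-rule⁻¹ {i} e with rule i
  mirrored-rule⁻¹ refl | node _ _ = refl

  mirrored-descending : Descending rule → Descending mirrored
  mirrored-descending desc e with desc (mirrored-rule⁻¹ e)
  ... | p , q = q , p

  mirrored-uses : ∀ term S → uses mirrored term S ≡ uses rule term S
  mirrored-uses term []      = refl
  mirrored-uses term (i ∷ S) = cong₂ _+_ (lem (rule i)) (mirrored-uses term S)
    where
    lem : ∀ r → b-children term (mirror r) ≡ b-children term r
    lem (leaf _)   = refl
    lem (node j k) = +-comm (b-count (term k)) (b-count (term j))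

RD-reverse : ∀ {N} {rule rule′ : Fin N → Rule N} {term Fr} → (∀ {i j k} → rule i ≡ node j k → rule′ i ≡ node k j) →
             ∀ {i u} → RD rule term Fr i u → RD rule′ term Fr i (reverse u)
RD-reverse h (terminal e) = terminal e
RD-reverse {rule′ = rule′} {term} {Fr} h {i} (inner {u = u} {v} e f r d₁ d₂) =
  subst (RD rule′ term Fr i) (sym (reverse-++ u v)) (inner e f (h r) (RD-reverse h d₂) (RD-reverse h d₁))

-- The mirrored grammar derives the reversed word, and mirroring rules changes neither the expanded
-- set nor the number of children equal to `b`. A phrase bound for the reversed word thus restricts
-- the original grammar.
expand-mirrored : ∀ {N} {rule : Fin N → Rule N} {term Fr i w k} → Descending rule → term i ≡ nothing →
  RD rule term Fr i w → LB (reverse w) k →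
  ∃[ S ] (RD rule term (_∈ S) i w × Unique S × All Fr S × k + uses rule term S ≤ suc (length S))
expand-mirrored {rule = rule} {term} {i = i} {w} {k} desc e d lb
  with expand (mirrored-descending rule desc) e (RD-reverse (mirrored-rule rule) d)
... | expansion S t un fr tight = S ,
  subst (RD rule term (_∈ S) i) (reverse-involutive w) (RD-reverse (mirrored-rule⁻¹ rule) t) , un , fr ,
  subst (λ n → k + n ≤ suc (length S)) (mirrored-uses rule term S) (tight lb)

-- Bigrams of the words met by RePair

-- The words met by RePair on F_n: F_j and the two words xP_jy whose letters
-- x ≠ y are those of F_j = P_jxy or P_jyx, at level j = i + 4.
data Reduced : ℕ → List Letter → Set where
  fibonacci : ∀ i → Reduced i (pal (1 + i) ++ ends (odd (1 + i)))
  bPa       : ∀ i → Reduced i (b ∷ pal (1 + i) ++ [ a ])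
  aPb       : ∀ i → Reduced i (a ∷ pal (1 + i) ++ [ b ])

reduced-occ : ∀ {i w} → Reduced i w → ∀ c → occ c w ≡ suc (occ c (pal (1 + i)))
reduced-occ (fibonacci i) c = trans (occ-++ c (pal (1 + i)) _) (trans (+-comm (occ c (pal (1 + i))) _)
                                (cong (_+ occ c (pal (1 + i))) (lem c (odd (1 + i)))))
  where
  lem : ∀ c o → occ c (ends o) ≡ 1
  lem a false = refl
  lem a true  = refl
  lem b false = refl
  lem b true  = refl
reduced-occ (bPa i) a = trans (occ-++ a (pal (1 + i)) [ a ]) (+-comm _ 1)
reduced-occ (bPa i) b = cong suc (trans (occ-++ b (pal (1 + i)) [ a ]) (+-identityʳ _))
reduced-occ (aPb i) a = cong suc (trans (occ-++ a (pal (1 + i)) [ b ]) (+-identityʳ _))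
reduced-occ (aPb i) b = trans (occ-++ b (pal (1 + i)) [ b ]) (+-comm _ 1)

reduced-occ-b<occ-a : ∀ {i w} → Reduced i w → occ b w < occ a w
reduced-occ-b<occ-a {i} R rewrite reduced-occ R a | reduced-occ R b = s≤s (occ-b<occ-a-pal i)

reduced-occ-b : ∀ {i w} → Reduced i w → 1 ≤ occ b w
reduced-occ-b R rewrite reduced-occ R b = s≤s z≤n

Unσ Unτ : ℕ → List Letter → Set
Unσ i w = ∃[ v ] (w ≡ σ v × Reduced i v)
Unτ i w = ∃[ v ] (w ≡ τ v × Reduced i v)

-- The second alternative is recorded as a leading `b` because this says more than the absence of a
-- preimage: that `b` has no `a` before it, so `ab` occurs less often than `b`.
unσ : ∀ {i w} → Reduced (suc i) w → Unσ i w ⊎ (∃[ w′ ] w ≡ b ∷ w′)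
unσ (fibonacci (suc i)) = inj₁ (_ , lem (odd (1 + i)) , fibonacci i)
  where
  lem : ∀ o → pal (2 + i) ++ ends (not o) ≡ σ (pal (1 + i) ++ ends o)
  lem false = trans (++-assoc (σ (pal (1 + i))) [ a ] _) (sym (σ-++ (pal (1 + i)) _))
  lem true  = trans (++-assoc (σ (pal (1 + i))) [ a ] _) (sym (σ-++ (pal (1 + i)) _))
unσ (bPa (suc i)) = inj₂ (_ , refl)
unσ (aPb (suc i)) = inj₁ (_ , cong (a ∷_) (trans (++-assoc (σ (pal (1 + i))) [ a ] [ b ])
                       (sym (σ-++ (pal (1 + i)) [ a ]))) , bPa i)

-- A Fibonacci word ending in `ba` has a preimage under `τ` too: by conjugacy, `σ P ++ [ a ]`
-- followed by `ba` equals `a ∷ τ P` followed by `ba`, which is the `τ`-image of bPa. A final `b`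
-- has no `a` after it, so it costs an occurrence of `ba`.
unτ : ∀ {i w} → Reduced (suc i) w → Unτ i w ⊎ (∃[ w′ ] w ≡ w′ ++ [ b ])
unτ (fibonacci (suc i)) with odd (1 + i)
... | true  = inj₂ (pal (2 + i) ++ [ a ] , sym (++-assoc (pal (2 + i)) [ a ] [ b ]))
... | false = inj₁ (_ , sym (trans (cong (a ∷_) (τ-++ (pal (1 + i)) [ a ]))
                (cong (_++ τ [ a ]) (sym (σ-τ-conjugate (pal (1 + i)))))) , bPa i)
unτ (bPa (suc i)) = inj₁ (_ , cong (b ∷_) lem , aPb i)
  where
  lem : pal (2 + i) ++ [ a ] ≡ a ∷ τ (pal (1 + i) ++ [ b ])
  lem = trans (cong (_++ [ a ]) (σ-τ-conjugate (pal (1 + i)))) (cong (a ∷_) (sym (τ-++ (pal (1 + i)) [ b ])))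
unτ (aPb (suc i)) = inj₂ (a ∷ pal (2 + i) , refl)

un-σ-or-τ : ∀ {i w} → Reduced (suc i) w → Unσ i w ⊎ Unτ i w
un-σ-or-τ R@(fibonacci (suc i)) with unσ R
... | inj₁ u = inj₁ u
... | inj₂ (w′ , e) = ⊥-elim (head (not (odd (1 + i))) e)
  where
  head : ∀ o {w′} → pal (2 + i) ++ ends o ≢ b ∷ w′
  head o e with trans (sym (cong (_++ ends o) (σ-τ-conjugate (pal (1 + i))))) e
  ... | ()
un-σ-or-τ R@(bPa (suc i)) with unτ R
... | inj₁ u = inj₂ u
... | inj₂ (w′ , e) with ∷ʳ-injectiveʳ (b ∷ pal (2 + i)) w′ e
...   | ()
un-σ-or-τ R@(aPb _) with unσ R
... | inj₁ u = inj₁ u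
... | inj₂ (_ , ())

reduced-occ-b-suc : ∀ {i w} → Reduced (suc i) w → 2 ≤ occ b w
reduced-occ-b-suc R with un-σ-or-τ R
... | inj₁ (v , refl , R′) rewrite occ-b-σ v = ≤-trans (s≤s (reduced-occ-b R′)) (reduced-occ-b<occ-a R′)
... | inj₂ (v , refl , R′) rewrite occ-b-τ v = ≤-trans (s≤s (reduced-occ-b R′)) (reduced-occ-b<occ-a R′)

reduced-occ-a<2occ-b : ∀ {i w} → Reduced (suc i) w → occ a w < occ b w + occ b w
reduced-occ-a<2occ-b R with un-σ-or-τ R
... | inj₁ (v , refl , R′) rewrite occ-b-σ v | occ-a-σ v = +-monoʳ-< (occ a v) (reduced-occ-b<occ-a R′)
... | inj₂ (v , refl , R′) rewrite occ-b-τ v | occ-a-τ v = +-monoʳ-< (occ a v) (reduced-occ-b<occ-a R′)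

_==_ : Letter → Letter → Bool
a == a = true
b == b = true
a == b = false
b == a = false

-- This is `count` on letters, where comparisons compute; `count-map` carries the results over to
-- strings of non-terminals.
bigrams     : Letter → Letter → List Letter → ℕ
bigramsFrom : Letter → Letter → Letter → List Letter → ℕ
bigrams x y []      = 0
bigrams x y (c ∷ r) = bigramsFrom x y c r
bigramsFrom x y c []      = 0
bigramsFrom x y c (d ∷ r) with (c == x) ∧ (d == y)
... | true  = suc (bigrams x y r)
... | false = bigramsFrom x y d r

==⇒≡ : ∀ c d → (c == d) ≡ true → c ≡ d
==⇒≡ a a _ = refl
==⇒≡ b b _ = refl

∧-true : ∀ {x y} → x ∧ y ≡ true → x ≡ true × y ≡ true
∧-true {true} {true} _ = refl , refl

occ-∷-self : ∀ c w → occ c (c ∷ w) ≡ suc (occ c w)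
occ-∷-self a w = refl
occ-∷-self b w = refl

occ-∷-≤ : ∀ c d w → occ c w ≤ occ c (d ∷ w)
occ-∷-≤ a a w = n≤1+n _
occ-∷-≤ a b w = ≤-refl
occ-∷-≤ b a w = ≤-refl
occ-∷-≤ b b w = n≤1+n _

bigrams≤occ     : ∀ x y w → bigrams x y w ≤ occ y w
bigramsFrom≤occ : ∀ x y c w → bigramsFrom x y c w ≤ occ y w
bigrams≤occ x y []      = z≤n
bigrams≤occ x y (c ∷ w) = ≤-trans (bigramsFrom≤occ x y c w) (occ-∷-≤ y c w)
bigramsFrom≤occ x y c []      = z≤n
bigramsFrom≤occ x y c (d ∷ w) with (c == x) ∧ (d == y) in eq
... | false = ≤-trans (bigramsFrom≤occ x y d w) (occ-∷-≤ y d w)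
... | true with ==⇒≡ d y (proj₂ (∧-true eq))
...   | refl = ≤-trans (s≤s (bigrams≤occ x y w)) (≤-reflexive (sym (occ-∷-self y w)))

bigrams≤occ-init     : ∀ x y w z → bigrams x y (w ++ [ z ]) ≤ occ x w
bigramsFrom≤occ-init : ∀ x y c w z → bigramsFrom x y c (w ++ [ z ]) ≤ occ x (c ∷ w)
bigrams≤occ-init x y []      z = z≤n
bigrams≤occ-init x y (c ∷ w) z = bigramsFrom≤occ-init x y c w z
bigramsFrom≤occ-init x y c [] z with (c == x) ∧ (z == y) in eq
... | false = z≤n
... | true with ==⇒≡ c x (proj₁ (∧-true eq))
...   | refl = ≤-reflexive (sym (occ-∷-self c []))
bigramsFrom≤occ-init x y c (d ∷ w) z with (c == x) ∧ (d == y) in eq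
... | false = ≤-trans (bigramsFrom≤occ-init x y d w z) (occ-∷-≤ x c (d ∷ w))
... | true with ==⇒≡ c x (proj₁ (∧-true eq))
...   | refl = ≤-trans (s≤s (≤-trans (bigrams≤occ-init x y w z) (occ-∷-≤ x d w)))
                       (≤-reflexive (sym (occ-∷-self x (d ∷ w))))

bigrams-ab-σ : ∀ v → bigrams a b (σ v) ≡ occ a v
bigrams-ab-σ []          = refl
bigrams-ab-σ (a ∷ v)     = cong suc (bigrams-ab-σ v)
bigrams-ab-σ (b ∷ [])    = refl
bigrams-ab-σ (b ∷ a ∷ v) = bigrams-ab-σ (a ∷ v)
bigrams-ab-σ (b ∷ b ∷ v) = bigrams-ab-σ (b ∷ v)

bigrams-ba-τ : ∀ v → bigrams b a (τ v) ≡ occ a v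
bigrams-ba-τ []          = refl
bigrams-ba-τ (a ∷ v)     = cong suc (bigrams-ba-τ v)
bigrams-ba-τ (b ∷ [])    = refl
bigrams-ba-τ (b ∷ a ∷ v) = bigrams-ba-τ (a ∷ v)
bigrams-ba-τ (b ∷ b ∷ v) = bigrams-ba-τ (b ∷ v)

-- In `σ v` a bigram `aa` can begin only at the image of a `b`. In `τ v` it can end only at the
-- image of a `b`, which is why the version for `τ` also tracks a preceding `a`.
bigrams-aa-σ : ∀ v → bigrams a a (σ v) ≤ occ b v
bigrams-aa-σ []          = z≤n
bigrams-aa-σ (a ∷ [])    = z≤n
bigrams-aa-σ (a ∷ a ∷ v) = bigrams-aa-σ (a ∷ v)
bigrams-aa-σ (a ∷ b ∷ v) = bigrams-aa-σ (b ∷ v)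
bigrams-aa-σ (b ∷ [])    = z≤n
bigrams-aa-σ (b ∷ a ∷ []) = ≤-refl
bigrams-aa-σ (b ∷ a ∷ a ∷ v) = s≤s (bigrams-aa-σ (a ∷ v))
bigrams-aa-σ (b ∷ a ∷ b ∷ v) = s≤s (bigrams-aa-σ (b ∷ v))
bigrams-aa-σ (b ∷ b ∷ v) = s≤s (≤-trans (bigrams-aa-σ v) (n≤1+n _))

bigrams-aa-τ  : ∀ v → bigrams a a (τ v) ≤ occ b v
bigrams-aa-aτ : ∀ v → bigrams a a (a ∷ τ v) ≤ occ b v
bigrams-aa-τ []      = z≤n
bigrams-aa-τ (a ∷ v) = bigrams-aa-aτ v
bigrams-aa-τ (b ∷ v) = ≤-trans (bigrams-aa-aτ v) (n≤1+n _)
bigrams-aa-aτ []      = z≤n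
bigrams-aa-aτ (a ∷ v) = bigrams-aa-aτ v
bigrams-aa-aτ (b ∷ v) = s≤s (bigrams-aa-τ v)

bigramsFrom-bb-σ : ∀ c v → bigramsFrom b b c (σ v) ≡ 0
bigramsFrom-bb-σ c []      = refl
bigramsFrom-bb-σ a (a ∷ v) = bigramsFrom-bb-σ b v
bigramsFrom-bb-σ b (a ∷ v) = bigramsFrom-bb-σ b v
bigramsFrom-bb-σ a (b ∷ v) = bigramsFrom-bb-σ a v
bigramsFrom-bb-σ b (b ∷ v) = bigramsFrom-bb-σ a v

bigrams-bb-σ : ∀ v → bigrams b b (σ v) ≡ 0
bigrams-bb-σ []      = refl
bigrams-bb-σ (a ∷ v) = bigramsFrom-bb-σ b v
bigrams-bb-σ (b ∷ v) = bigramsFrom-bb-σ a v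

bigramsFrom-bb-τ : ∀ v → bigramsFrom b b a (τ v) ≡ 0
bigramsFrom-bb-τ []      = refl
bigramsFrom-bb-τ (a ∷ v) = bigramsFrom-bb-τ v
bigramsFrom-bb-τ (b ∷ v) = bigramsFrom-bb-τ v

bigrams-bb-τ : ∀ v → bigrams b b (τ v) ≡ 0
bigrams-bb-τ []      = refl
bigrams-bb-τ (a ∷ v) = bigramsFrom-bb-τ v
bigrams-bb-τ (b ∷ v) = bigramsFrom-bb-τ v

reduced-bigrams-aa : ∀ {i w} → Reduced (suc i) w → bigrams a a w < occ b w
reduced-bigrams-aa R with un-σ-or-τ R
... | inj₁ (v , refl , R′) rewrite occ-b-σ v = ≤-<-trans (bigrams-aa-σ v) (reduced-occ-b<occ-a R′)
... | inj₂ (v , refl , R′) rewrite occ-b-τ v = ≤-<-trans (bigrams-aa-τ v) (reduced-occ-b<occ-a R′)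

reduced-bigrams-bb : ∀ {i w} → Reduced (suc i) w → bigrams b b w < occ b w
reduced-bigrams-bb R = ≤-trans (s≤s (≤-reflexive (lem R))) (reduced-occ-b R)
  where
  lem : ∀ {i w} → Reduced (suc i) w → bigrams b b w ≡ 0
  lem R with un-σ-or-τ R
  ... | inj₁ (v , refl , _) = bigrams-bb-σ v
  ... | inj₂ (v , refl , _) = bigrams-bb-τ v

reduced-bigrams-ab : ∀ {i w} → Reduced (suc i) w → Unσ i w ⊎ bigrams a b w < occ b w
reduced-bigrams-ab R with unσ R
... | inj₁ u = inj₁ u
... | inj₂ (w′ , refl) = inj₂ (s≤s (bigramsFrom≤occ a b b w′))

reduced-bigrams-ba : ∀ {i w} → Reduced (suc i) w → Unτ i w ⊎ bigrams b a w < occ b w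
reduced-bigrams-ba R with unτ R
... | inj₁ u = inj₁ u
... | inj₂ (w′ , refl) = inj₂ (≤-trans (s≤s (bigrams≤occ-init b a w′ b))
        (≤-reflexive (trans (+-comm 1 _) (sym (occ-++ b w′ [ b ])))))

module _ {k} (f : Letter → Fin k) (fa≢fb : f a ≢ f b) where

  does-≟ : ∀ c d → does (f c ≟ f d) ≡ (c == d)
  does-≟ a a = dec-true (f a ≟ f a) refl
  does-≟ b b = dec-true (f b ≟ f b) refl
  does-≟ a b = dec-false (f a ≟ f b) fa≢fb
  does-≟ b a = dec-false (f b ≟ f a) (λ e → fa≢fb (sym e))

  count-map     : ∀ x y w → count (f x) (f y) (map f w) ≡ bigrams x y w
  countFrom-map : ∀ x y c w → countFrom (f x) (f y) (f c) (map f w) ≡ bigramsFrom x y c w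
  count-map x y []      = refl
  count-map x y (c ∷ w) = countFrom-map x y c w
  countFrom-map x y c []      = refl
  countFrom-map x y c (d ∷ w) rewrite does-≟ c x | does-≟ d y with (c == x) ∧ (d == y)
  ... | true  = cong suc (count-map x y w)
  ... | false = countFrom-map x y d w

  replace-hit : ∀ x y r → replace (f x) (f y) (f x ∷ f y ∷ r) ≡ fromℕ k ∷ replace (f x) (f y) r
  replace-hit x y r rewrite dec-true (f x ≟ f x) refl | dec-true (f y ≟ f y) refl = refl

  replace-miss : ∀ x y c d r → (c == x) ∧ (d == y) ≡ false →
    replace (f x) (f y) (f c ∷ f d ∷ r) ≡ inject₁ (f c) ∷ replace (f x) (f y) (f d ∷ r)
  replace-miss x y c d r e rewrite does-≟ c x | does-≟ d y | e = refl

  next : Letter → Fin (suc k)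
  next a = fromℕ k
  next b = inject₁ (f a)

  replace-σ : ∀ v → replace (f a) (f b) (map f (σ v)) ≡ map next v
  replace-σ []          = refl
  replace-σ (a ∷ v)     = trans (replace-hit a b (map f (σ v))) (cong (fromℕ k ∷_) (replace-σ v))
  replace-σ (b ∷ [])    = refl
  replace-σ (b ∷ a ∷ v) = trans (replace-miss a b a a (map f (b ∷ σ v)) refl) (cong (_ ∷_) (replace-σ (a ∷ v)))
  replace-σ (b ∷ b ∷ v) = trans (replace-miss a b a a (map f (σ v)) refl) (cong (_ ∷_) (replace-σ (b ∷ v)))

  replace-τ : ∀ v → replace (f b) (f a) (map f (τ v)) ≡ map next v
  replace-τ []          = refl
  replace-τ (a ∷ v)     = trans (replace-hit b a (map f (τ v))) (cong (fromℕ k ∷_) (replace-τ v))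
  replace-τ (b ∷ [])    = refl
  replace-τ (b ∷ a ∷ v) = trans (replace-miss b a a b (map f (a ∷ τ v)) refl) (cong (_ ∷_) (replace-τ (a ∷ v)))
  replace-τ (b ∷ b ∷ v) = trans (replace-miss b a a a (map f (τ v)) refl) (cong (_ ∷_) (replace-τ (b ∷ v)))

  next-distinct : next a ≢ next b
  next-distinct e = fromℕ≢inject₁ e

  count-absent     : ∀ p q → (∀ l → f l ≢ p) ⊎ (∀ l → f l ≢ q) → ∀ w → count p q (map f w) ≡ 0
  countFrom-absent : ∀ p q → (∀ l → f l ≢ p) ⊎ (∀ l → f l ≢ q) → ∀ c w → countFrom p q (f c) (map f w) ≡ 0
  count-absent p q h []      = refl
  count-absent p q h (c ∷ w) = countFrom-absent p q h c w
  countFrom-absent p q h c [] = refl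
  countFrom-absent p q h c (d ∷ w) with does (f c ≟ p) ∧ does (f d ≟ q) in eq
  ... | false = countFrom-absent p q h d w
  ... | true with h
  ...   | inj₁ n with trans (sym (dec-false (f c ≟ p) (n c))) (proj₁ (∧-true eq))
  ...     | ()
  countFrom-absent p q h c (d ∷ w) | true | inj₂ n with trans (sym (dec-false (f d ≟ q) (n d))) (proj₂ (∧-true {does (f c ≟ p)} eq))
  ...     | ()

  letter? : ∀ p → (∃[ l ] f l ≡ p) ⊎ (∀ l → f l ≢ p)
  letter? p with f a ≟ p | f b ≟ p
  ... | yes e | _     = inj₁ (a , e)
  ... | no _  | yes e = inj₁ (b , e)
  ... | no m  | no n  = inj₂ (λ { a → m ; b → n })

  -- In these cases each `b` pairs with its own neighbouring `a`, so the bigram occurs `occ b w`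
  -- times. By `best?` all other bigrams occur strictly less often, so these are exactly the choices
  -- open to RePair.
  Best : ℕ → List Letter → Fin k → Fin k → Set
  Best i w p q = (p ≡ f a × q ≡ f b × Unσ i w) ⊎ (p ≡ f b × q ≡ f a × Unτ i w)

  best? : ∀ {i w} → Reduced (suc i) w → ∀ p q → Best i w p q ⊎ count p q (map f w) < occ b w
  best? {i} {w} R p q with letter? p | letter? q
  ... | inj₂ n | _ = inj₂ (≤-trans (s≤s (≤-reflexive (count-absent p q (inj₁ n) w))) (reduced-occ-b R))
  ... | _ | inj₂ n = inj₂ (≤-trans (s≤s (≤-reflexive (count-absent p q (inj₂ n) w))) (reduced-occ-b R))
  ... | inj₁ (x , refl) | inj₁ (y , refl) rewrite count-map x y w with x | y
  ...   | a | a = inj₂ (reduced-bigrams-aa R)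
  ...   | b | b = inj₂ (reduced-bigrams-bb R)
  ...   | a | b with reduced-bigrams-ab R
  ...     | inj₁ u = inj₁ (inj₁ (refl , refl , u))
  ...     | inj₂ n = inj₂ n
  best? {i} {w} R p q | inj₁ (x , refl) | inj₁ (y , refl) | b | a with reduced-bigrams-ba R
  ...     | inj₁ u = inj₁ (inj₂ (refl , refl , u))
  ...     | inj₂ n = inj₂ n

  count-best : ∀ {i w p q} → Best i w p q → count p q (map f w) ≡ occ b w
  count-best {w = w} (inj₁ (refl , refl , v , refl , _)) = trans (count-map a b w) (trans (bigrams-ab-σ v) (sym (occ-b-σ v)))
  count-best {w = w} (inj₂ (refl , refl , v , refl , _)) = trans (count-map b a w) (trans (bigrams-ba-τ v) (sym (occ-b-τ v)))

  best-maximal : ∀ {i w p q} → Reduced (suc i) w → Best i w p q → ∀ p′ q′ → count p′ q′ (map f w) ≤ count p q (map f w)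
  best-maximal R B p′ q′ rewrite count-best B with best? R p′ q′
  ... | inj₁ B′ = ≤-reflexive (count-best B′)
  ... | inj₂ lt = <⇒≤ lt

  maximal-best : ∀ {i w p q} → Reduced (suc i) w → (∀ p′ q′ → count p′ q′ (map f w) ≤ count p q (map f w)) → Best i w p q
  maximal-best {i} {w} {p} {q} R max with best? R p q
  ... | inj₁ B = B
  ... | inj₂ lt with un-σ-or-τ R
  ...   | inj₁ u = ⊥-elim (<⇒≱ lt (≤-trans (≤-reflexive (sym (count-best (inj₁ (refl , refl , u))))) (max (f a) (f b))))
  ...   | inj₂ u = ⊥-elim (<⇒≱ lt (≤-trans (≤-reflexive (sym (count-best (inj₂ (refl , refl , u))))) (max (f b) (f a))))

  Best-replace : ∀ {i w p q} → Best i w p q → ∃[ v ] (Reduced i v × replace p q (map f w) ≡ map next v)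
  Best-replace (inj₁ (refl , refl , v , refl , R)) = v , R , replace-σ v
  Best-replace (inj₂ (refl , refl , v , refl , R)) = v , R , replace-τ v

count-twice≤length     : ∀ {k} (p q : Fin k) s → count p q s + count p q s ≤ length s
countFrom-twice≤length : ∀ {k} (p q c : Fin k) s → countFrom p q c s + countFrom p q c s ≤ suc (length s)
count-twice≤length p q []      = z≤n
count-twice≤length p q (c ∷ s) = countFrom-twice≤length p q c s
countFrom-twice≤length p q c [] = z≤n
countFrom-twice≤length p q c (d ∷ s) with does (c ≟ p) ∧ does (d ≟ q)
... | true  = s≤s (≤-trans (≤-reflexive (+-suc _ _)) (s≤s (count-twice≤length p q s)))
... | false = ≤-trans (countFrom-twice≤length p q d s) (n≤1+n _)

short-count<2 : ∀ {k} (p q : Fin k) s → length s ≤ 3 → count p q s < 2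
short-count<2 p q s l = ≰⇒> (λ g → <-irrefl refl (≤-trans (+-mono-≤ g g) (≤-trans (count-twice≤length p q s) l)))

-- Soundness and size

lookup-inject₁ : ∀ {n} (G : SLP n) r i → lookup (G ▷ r) (inject₁ i) ≡ wkRule (lookup G i)
lookup-inject₁ {n} G r i with toℕ (inject₁ i) <? n
... | no p  = ⊥-elim (p (inject₁ℕ< i))
... | yes p = cong (λ j → wkRule (lookup G j)) (lem p)
  where
  lem : (p : toℕ (inject₁ i) < n) → fromℕ< p ≡ i
  lem p = toℕ-injective (trans (toℕ-fromℕ< p) (toℕ-inject₁ i))

lookup-fromℕ : ∀ {n} (G : SLP n) r → lookup (G ▷ r) (fromℕ n) ≡ wkRule r
lookup-fromℕ {n} G r with toℕ (fromℕ n) <? n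
... | no _  = refl
... | yes p = ⊥-elim (<-irrefl (toℕ-fromℕ n) p)

wkRule-node : ∀ {n} (r : Rule n) {j k} → wkRule r ≡ node j k →
              ∃[ j′ ] ∃[ k′ ] (r ≡ node j′ k′ × j ≡ inject₁ j′ × k ≡ inject₁ k′)
wkRule-node (node j k) refl = j , k , refl , refl , refl

lookup-descending : ∀ {n} (G : SLP n) → Descending (lookup G)
lookup-descending (_▷_ {n} G r) {i} e with view i
... | ‵fromℕ with wkRule-node r (trans (sym (lookup-fromℕ G r)) e)
...   | j , k , _ , refl , refl = below j , below k
  where
  below : ∀ j → toℕ (inject₁ j) < toℕ (fromℕ n)
  below j = ≤-trans (inject₁ℕ< j) (≤-reflexive (sym (toℕ-fromℕ n)))
lookup-descending (_▷_ {n} G r) e | ‵inject₁ i with wkRule-node (lookup G i) (trans (sym (lookup-inject₁ G r i)) e)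
...   | j , k , e′ , refl , refl = lift (proj₁ (lookup-descending G e′)) , lift (proj₂ (lookup-descending G e′))
  where
  lift : ∀ {j i : Fin n} → toℕ j < toℕ i → toℕ (inject₁ j) < toℕ (inject₁ i)
  lift {j} {i} = subst₂ _<_ (sym (toℕ-inject₁ j)) (sym (toℕ-inject₁ i))

derives-weaken : ∀ {n} {G : SLP n} {r i u} → Derives G i u → Derives (G ▷ r) (inject₁ i) u
derives-weaken {G = G} {r} (dleaf e) = dleaf (trans (lookup-inject₁ G r _) (cong wkRule e))
derives-weaken {G = G} {r} (dnode e d₁ d₂) =
  dnode (trans (lookup-inject₁ G r _) (cong wkRule e)) (derives-weaken d₁) (derives-weaken d₂)

derives-last : ∀ {n} {G : SLP n} {x y u v} → Derives G x u → Derives G y v →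
               Derives (G ▷ node x y) (fromℕ n) (u ++ v)
derives-last {G = G} d₁ d₂ = dnode (lookup-fromℕ G _) (derives-weaken d₁) (derives-weaken d₂)

data Spells {n} (G : SLP n) : List (Fin n) → List Letter → Set where
  []  : Spells G [] []
  _∷_ : ∀ {i s u w} → Derives G i u → Spells G s w → Spells G (i ∷ s) (u ++ w)

spells-weaken : ∀ {n} {G : SLP n} {r s w} → Spells G s w → Spells (G ▷ r) (map inject₁ s) w
spells-weaken []       = []
spells-weaken (d ∷ ds) = derives-weaken d ∷ spells-weaken ds

spells-replace : ∀ {n} {G : SLP n} (x y : Fin n) {s w} → Spells G s w →
                 Spells (G ▷ node x y) (replace x y s) w
spells-replaceFrom : ∀ {n} {G : SLP n} (x y : Fin n) {c s u w} → Derives G c u → Spells G s w →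
                     Spells (G ▷ node x y) (replaceFrom x y c s) (u ++ w)
spells-replace x y []       = []
spells-replace x y (d ∷ ds) = spells-replaceFrom x y d ds
spells-replaceFrom x y d [] = derives-weaken d ∷ []
spells-replaceFrom {G = G} x y {c} {e ∷ s} {u} d₁ (_∷_ {u = u′} {w} d₂ ds) with c ≟ x | e ≟ y
... | yes refl | yes refl = subst (Spells _ _) (++-assoc u u′ w) (derives-last d₁ d₂ ∷ spells-replace x y ds)
... | yes _    | no _     = derives-weaken d₁ ∷ spells-replaceFrom x y d₂ ds
... | no _     | _        = derives-weaken d₁ ∷ spells-replaceFrom x y d₂ ds

spells-merge : ∀ {n} {G : SLP n} u {x y v w} → Spells G (u ++ x ∷ y ∷ v) w →
               Spells (G ▷ node x y) (map inject₁ u ++ fromℕ n ∷ map inject₁ v) w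
spells-merge []      (_∷_ {u = u₁} d₁ (_∷_ {u = u₂} {w} d₂ ds)) =
  subst (Spells _ _) (++-assoc u₁ u₂ w) (derives-last d₁ d₂ ∷ spells-weaken ds)
spells-merge (_ ∷ u) (d ∷ ds) = derives-weaken d ∷ spells-merge u ds

-- `Replace` leaves the number of productions of its result open, whereas `GrammarOf` requires a
-- nonempty grammar.
Generates : ∀ {m} → SLP m → List Letter → Set
Generates {zero}  G w = ⊥
Generates {suc m} G w = GrammarOf G w

combine-generates : ∀ {n} {G : SLP n} {s m} {H : SLP m} {w} → Combine G s H → Spells G s w → Generates H w
combine-generates (done G) (_∷_ {u = u} d []) = subst (Derives G _) (sym (++-identityʳ u)) d
combine-generates (merge u x y v c) ds = combine-generates c (spells-merge u ds)

replace-generates : ∀ {n} {G : SLP n} {s m} {H : SLP m} {w} → Replace G s H → Spells G s w → Generates H w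
replace-generates (stop _ c)     ds = combine-generates c ds
replace-generates (step x y _ _ r) ds = replace-generates r (spells-replace x y ds)

combine-size : ∀ {n} {G : SLP n} {s m} {H : SLP m} → Combine G s H → suc m ≡ n + length s
combine-size (done {k} G) = +-comm 1 (suc k)
combine-size {n} (merge u x y v c) = trans (combine-size c) (trans (cong (suc n +_) len)
    (sym (trans (cong (n +_) (trans (length-++ u) (+-suc (length u) _))) (+-suc n _))))
  where
  len : length (map inject₁ u ++ fromℕ n ∷ map inject₁ v) ≡ length u + suc (length v)
  len = trans (length-++ (map inject₁ u)) (cong₂ (λ x y → x + suc y) (length-map inject₁ u) (length-map inject₁ v))

replace-short-size : ∀ {n} {G : SLP n} {s m} {H : SLP m} → length s ≤ 3 → Replace G s H → suc m ≡ n + length s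
replace-short-size l (stop _ c) = combine-size c
replace-short-size {s = s} l (step x y two _ _) = ⊥-elim (<⇒≱ (short-count<2 x y s l) two)

reduced-zero-length : ∀ {w} → Reduced 0 w → length w ≡ 3
reduced-zero-length (fibonacci .0) = refl
reduced-zero-length (bPa .0) = refl
reduced-zero-length (aPb .0) = refl

-- Above level 0 a best bigram still occurs twice, so RePair cannot stop; each step adds one rule
-- and lowers the level by one, whatever the choice. At level 0 three letters remain and take two
-- rules.
replace-size : ∀ {i w} → Reduced i w → ∀ {n} (f : Letter → Fin n) → f a ≢ f b → ∀ {G : SLP n} {m} {H : SLP m} →
               Replace G (map f w) H → m ≡ n + (2 + i)
replace-size {zero} {w} R {n} f f≢ r = suc-injective (trans
    (replace-short-size (≤-reflexive (trans (length-map f w) (reduced-zero-length R))) r)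
    (trans (cong (n +_) (trans (length-map f w) (reduced-zero-length R))) (+-suc n 2)))
replace-size {suc i} {w} R f f≢ (stop small _) = ⊥-elim (<-irrefl refl (<-≤-trans (small _ _)
    (≤-trans (reduced-occ-b-suc R) (≤-reflexive (sym (count-best f f≢ (proj₂ (proj₂ B))))))))
  where
  B : ∃[ p ] ∃[ q ] Best f f≢ i w p q
  B with un-σ-or-τ R
  ... | inj₁ u = _ , _ , inj₁ (refl , refl , u)
  ... | inj₂ u = _ , _ , inj₂ (refl , refl , u)
replace-size {suc i} R {n} f f≢ (step p q _ max r) with Best-replace f f≢ (maximal-best f f≢ R max)
... | v , R′ , e rewrite e =
  trans (replace-size R′ (next f f≢) (next-distinct f f≢) r) (sym (+-suc n (2 + i)))

-- Lower bound on the size of any grammar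

lookup-injective : ∀ {A : Set} {xs : List A} → Unique xs → ∀ {i j} → List.lookup xs i ≡ List.lookup xs j → i ≡ j
lookup-injective (_ ∷ _)  {zero}  {zero}  e = refl
lookup-injective {xs = _ ∷ xs} (n ∷ _) {zero} {suc j} e = ⊥-elim (All.lookup n (∈-lookup {xs = xs} j) e)
lookup-injective {xs = _ ∷ xs} (n ∷ _) {suc i} {zero} e = ⊥-elim (All.lookup n (∈-lookup {xs = xs} i) (sym e))
lookup-injective (_ ∷ un) {suc i} {suc j} e = cong suc (lookup-injective un e)

unique-length≤ : ∀ {n} {xs : List (Fin n)} → Unique xs → length xs ≤ n
unique-length≤ un = injective⇒≤ (lookup-injective un)

leafTerm : ∀ {n} → Rule n → Maybe Letter
leafTerm (leaf c)   = just c
leafTerm (node _ _) = nothing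

module _ {n} (G : SLP n) where

  leafAt : Fin n → Maybe Letter
  leafAt i = leafTerm (lookup G i)

  derives⇒RD : ∀ {i u} → Derives G i u → RD (lookup G) leafAt (λ i → leafAt i ≡ nothing) i u
  derives⇒RD (dleaf e)       = terminal (cong leafTerm e)
  derives⇒RD (dnode e d₁ d₂) = inner (cong leafTerm e) (cong leafTerm e) e (derives⇒RD d₁) (derives⇒RD d₂)

  leafAt-just : ∀ {i c} → leafAt i ≡ just c → lookup G i ≡ leaf c
  leafAt-just {i} e with lookup G i
  leafAt-just refl | leaf c = refl

find-terminal : ∀ {N} {rule : Fin N → Rule N} {term Fr i u} c → RD rule term Fr i u → 1 ≤ occ c u →
                ∃[ j ] term j ≡ just c
find-terminal a (terminal {c = a} e) _ = _ , e
find-terminal b (terminal {c = b} e) _ = _ , e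
find-terminal c (inner {u = u} {v} _ _ _ d₁ d₂) p with 1 ≤? occ c u
... | yes q = find-terminal c d₁ q
... | no q  = find-terminal c d₂ (subst (1 ≤_) (trans (occ-++ c u v) (cong (_+ occ c v) (n≤0⇒n≡0 (≤-pred (≰⇒> q))))) p)

-- The distinct non-terminals are kept as witnesses, not merely counted: in a grammar of minimum
-- size they leave no room for a third leaf rule.
record Census {n} (G : SLP n) (i : Fin n) (w : List Letter) (k : ℕ) : Set where
  field
    {A B}  : Fin n
    leafA  : leafAt G A ≡ just a
    leafB  : leafAt G B ≡ just b
    S      : List (Fin n)
    inners : All (λ i → leafAt G i ≡ nothing) S
    unique : Unique S
    many   : k ≤ length S

leaf∉inner : ∀ {n} {G : SLP n} {i c S} → leafAt G i ≡ just c → All (λ i → leafAt G i ≡ nothing) S → All (λ j → ¬ i ≡ j) S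
leaf∉inner e = All.map (λ { e′ refl → just≢nothing e e′ })

leaf≢leaf : ∀ {n} {G : SLP n} {i j c d} → leafAt G i ≡ just c → leafAt G j ≡ just d → c ≢ d → i ≢ j
leaf≢leaf e e′ c≢d refl = c≢d (just-injective (trans (sym e) e′))

census : ∀ {n} (G : SLP n) {i w k} → Derives G i w → 2 ≤ length w → 1 ≤ occ a w → 1 ≤ occ b w → LB w k → Census G i w k
census G {i} {w} {k} d len pa pb lb = record
  { leafA = proj₂ (find-terminal a t pa) ; leafB = proj₂ (find-terminal b t pb) ; S = S
  ; inners = free ; unique = unique
  ; many = ≤-pred (≤-trans (≤-trans (≤-reflexive (+-comm 1 k)) (+-monoʳ-≤ k used)) (tight lb)) }
  where
  t : RD (lookup G) (leafAt G) (λ i → leafAt G i ≡ nothing) i w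
  t = derives⇒RD G d
  is-inner : leafAt G i ≡ nothing
  is-inner = RD-inner t len
  open Expansion (expand (lookup-descending G) is-inner t)
  -- The word contains `b`, so some expanded rule has `b` as a child; this use absorbs the `suc` in
  -- `tight`.
  used : 1 ≤ uses (lookup G) (leafAt G) S
  used with find-b-user (lookup-descending G) derives is-inner pb
  ... | b-user X∈S _ _ r _ _ c = ≤-trans (b-child-used {rule = lookup G} r c) (uses-∈ {rule = lookup G} X∈S)

census-size : ∀ {n} {G : SLP n} {i w k} → Census G i w k → 2 + k ≤ n
census-size C = ≤-trans (s≤s (s≤s many)) (unique-length≤
    ((leaf≢leaf leafA leafB (λ ()) ∷ leaf∉inner leafA inners) ∷ leaf∉inner leafB inners ∷ unique))
  where open Census C

LB-fib-3+ : ∀ i → LB (fib (3 + i)) (1 + i)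
LB-fib-3+ zero    = LB-weaken [ b ] LB-a
LB-fib-3+ (suc i) = subst (λ w → LB w (2 + i)) (sym (fib-pal (suc i))) (LB-fib i)

fib-occ : ∀ i c → 1 ≤ occ c (fib (3 + i))
fib-occ i c rewrite fib-pal i | occ-++ c (pal i) (ends (odd i)) = ≤-trans (lem c (odd i)) (m≤n+m _ _)
  where
  lem : ∀ c o → 1 ≤ occ c (ends o)
  lem a false = ≤-refl
  lem a true  = ≤-refl
  lem b false = ≤-refl
  lem b true  = ≤-refl

fib-length : ∀ i → 2 ≤ length (fib (3 + i))
fib-length i rewrite fib-pal i | length-++ (pal i) {ends (odd i)} = ≤-trans (lem (odd i)) (m≤n+m _ _)
  where
  lem : ∀ o → 2 ≤ length (ends o)
  lem false = ≤-refl
  lem true  = ≤-refl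

fib-census : ∀ i {m} (G : SLP (suc m)) → GrammarOf G (fib (3 + i)) → Census G start (fib (3 + i)) (1 + i)
fib-census i G d = census G d (fib-length i) (fib-occ i a) (fib-occ i b) (LB-fib-3+ i)

-- Initial states and the size of RePair grammars

init-spells : ∀ {n} {G : SLP n} {s w} → Pointwise (λ i c → lookup G i ≡ leaf c) s w → Spells G s w
init-spells []       = []
init-spells (e ∷ es) = dleaf e ∷ init-spells es

init-contains : ∀ {n} {G : SLP n} {s w} c → Pointwise (λ i c → lookup G i ≡ leaf c) s w → 1 ≤ occ c w →
                ∃[ i ] lookup G i ≡ leaf c
init-contains c (_∷_ {y = y} e es) p with c | y
... | a | a = _ , e
... | b | b = _ , e
... | a | b = init-contains a es p
... | b | a = init-contains b es p

init-two-letters : ∀ {n} {G : SLP n} {s w} → InitState w G s → 1 ≤ occ a w → 1 ≤ occ b w →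
                   n ≡ 2 × ∃[ f ] (f a ≢ f b × s ≡ map f w)
init-two-letters {n} {G} {s} {w} (leaves , inj , _ , pw) pa pb = two , f , f≢ , named pw
  where
  f : Letter → Fin n
  f a = proj₁ (init-contains {G = G} a pw pa)
  f b = proj₁ (init-contains {G = G} b pw pb)
  fe : ∀ c → lookup G (f c) ≡ leaf c
  fe a = proj₂ (init-contains {G = G} a pw pa)
  fe b = proj₂ (init-contains {G = G} b pw pb)
  leaf-injective : ∀ {c d} → leaf {n} c ≡ leaf d → c ≡ d
  leaf-injective refl = refl
  f≢ : f a ≢ f b
  f≢ e with leaf-injective (trans (sym (fe a)) (trans (cong (lookup G) e) (fe b)))
  ... | ()
  named : ∀ {s w} → Pointwise (λ i c → lookup G i ≡ leaf c) s w → s ≡ map f w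
  named []       = refl
  named (e ∷ es) = cong₂ _∷_ (inj _ _ _ e (fe _)) (named es)
  code : Letter → Fin 2
  code a = zero
  code b = suc zero
  code-injective : ∀ {c d} → code c ≡ code d → c ≡ d
  code-injective {a} {a} _ = refl
  code-injective {b} {b} _ = refl
  label : Fin n → Letter
  label i = proj₁ (leaves i)
  two : n ≡ 2
  two = ≤-antisym
    (injective⇒≤ {f = λ i → code (label i)} (λ {i} {j} e → inj i j (label j)
       (trans (proj₂ (leaves i)) (cong leaf (code-injective e))) (proj₂ (leaves j))))
    (unique-length≤ {xs = f a ∷ f b ∷ []} ((f≢ ∷ []) ∷ [] ∷ []))

repair-size : ∀ i {m} (G : SLP (suc m)) → RePair (fib (3 + i)) G → suc m ≡ 3 + i
repair-size zero G (n , _ , s , init@(_ , _ , _ , pw) , r) with init-two-letters init ≤-refl ≤-refl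
... | refl , f , _ , refl = suc-injective (replace-short-size (s≤s (s≤s z≤n)) r)
repair-size (suc i) G (n , G₀ , s , init , r) with init-two-letters init (fib-occ (suc i) a) (fib-occ (suc i) b)
... | refl , f , f≢ , refl =
  replace-size (fibonacci i) f f≢ (subst (λ w → Replace G₀ (map f w) G) (fib-pal (suc i)) r)

repair-grammar : ∀ {w m} {G : SLP (suc m)} → RePair w G → GrammarOf G w
repair-grammar (_ , _ , _ , (_ , _ , _ , pw) , r) = replace-generates r (init-spells pw)

-- Following an optimal grammar by RePair steps

infixl 5 _▸_
_▸_ : ∀ {k} {A : Set} → (Fin k → A) → A → Fin (suc k) → A
(ι ▸ X) i with view i
... | ‵fromℕ     = X
... | ‵inject₁ j = ι j

▸-fromℕ : ∀ {k} {A : Set} (ι : Fin k → A) X → (ι ▸ X) (fromℕ k) ≡ X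
▸-fromℕ {k} ι X rewrite view-fromℕ k = refl

▸-inject₁ : ∀ {k} {A : Set} (ι : Fin k → A) X i → (ι ▸ X) (inject₁ i) ≡ ι i
▸-inject₁ ι X i rewrite view-inject₁ i = refl

mapRule-▸ : ∀ {k N} (ι : Fin k → Fin N) X r → mapRule (ι ▸ X) (wkRule r) ≡ mapRule ι r
mapRule-▸ ι X (leaf c)   = refl
mapRule-▸ ι X (node j k) = cong₂ node (▸-inject₁ ι X j) (▸-inject₁ ι X k)

occ≤length : ∀ c w → occ c w ≤ length w
occ≤length c []      = z≤n
occ≤length a (a ∷ w) = s≤s (occ≤length a w)
occ≤length a (b ∷ w) = m≤n⇒m≤1+n (occ≤length a w)
occ≤length b (a ∷ w) = m≤n⇒m≤1+n (occ≤length b w)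
occ≤length b (b ∷ w) = s≤s (occ≤length b w)

-- The word aPb is read from right to left, which turns it into bPa.
reduced-expansion : ∀ {N} {rule : Fin N → Rule N} {term Fr r i w} → Descending rule → Reduced (suc i) w →
  term r ≡ nothing → RD rule term Fr r w →
  ∃[ S ] (RD rule term (_∈ S) r w × Unique S × All Fr S × (3 + i) + uses rule term S ≤ suc (length S))
reduced-expansion desc (fibonacci (suc i)) e d with expand desc e d
... | expansion S t un fr tight = S , t , un , fr , tight (LB-fib (suc i))
reduced-expansion desc (bPa (suc i)) e d with expand desc e d
... | expansion S t un fr tight = S , t , un , fr , tight (LB-bpa i)
reduced-expansion desc (aPb (suc i)) e d = expand-mirrored desc e d
  (subst (λ w → LB w (3 + i)) (sym eq) (LB-bpa i))
  where
  eq : reverse (a ∷ pal (2 + i) ++ [ b ]) ≡ b ∷ pal (2 + i) ++ [ a ]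
  eq = trans (unfold-reverse a (pal (2 + i) ++ [ b ]))
         (cong (_++ [ a ]) (trans (reverse-++ (pal (2 + i)) [ b ]) (cong (b ∷_) (reverse-pal (2 + i)))))

module Build {N} (rule : Fin N → Rule N) (desc : Descending rule) (root : Fin N) where

  -- RePair numbers non-terminals in the order in which it creates them, so `ι` need not be
  -- monotone. A bijection is only obtained at the end, when the sizes agree.
  record Embeds {k} (H : SLP k) (ι : Fin k → Fin N) : Set where
    field
      inj : ∀ {i j} → ι i ≡ ι j → i ≡ j
      hom : ∀ i → rule (ι i) ≡ mapRule ι (lookup H i)

  embeds-▷ : ∀ {k} {H : SLP k} {ι X x y} → Embeds H ι → (∀ i → ι i ≢ X) → rule X ≡ node (ι x) (ι y) →
             Embeds (H ▷ node x y) (ι ▸ X)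
  embeds-▷ {k} {H} {ι} {X} {x} {y} E ι≢X r = record { inj = inj ; hom = hom }
    where
    inj : ∀ {i j} → (ι ▸ X) i ≡ (ι ▸ X) j → i ≡ j
    inj {i} {j} e with view i | view j
    ... | ‵fromℕ     | ‵fromℕ     = refl
    ... | ‵fromℕ     | ‵inject₁ j = ⊥-elim (ι≢X j (sym e))
    ... | ‵inject₁ i | ‵fromℕ     = ⊥-elim (ι≢X i e)
    ... | ‵inject₁ i | ‵inject₁ j = cong inject₁ (Embeds.inj E e)
    hom : ∀ i → rule ((ι ▸ X) i) ≡ mapRule (ι ▸ X) (lookup (H ▷ node x y) i)
    hom i with view i
    ... | ‵fromℕ = trans r (sym (trans (cong (mapRule (ι ▸ X)) (lookup-fromℕ H _)) (mapRule-▸ ι X (node x y))))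
    ... | ‵inject₁ i = trans (Embeds.hom E i)
            (sym (trans (cong (mapRule (ι ▸ X)) (lookup-inject₁ H _ i)) (mapRule-▸ ι X (lookup H i))))

  record Built {k} (H : SLP k) (s : List (Fin k)) (size : ℕ) : Set where
    constructor built
    field
      {K}     : ℕ
      {H′}    : SLP (suc K)
      {ι}     : Fin (suc K) → Fin N
      repair  : Replace H s H′
      embeds  : Embeds H′ ι
      at-root : ι (fromℕ K) ≡ root
      sized   : suc K ≡ size

  module _ {k} {H : SLP k} {ι : Fin k → Fin N} (E : Embeds H ι) (f : Letter → Fin k) {term}
           (T : Terminals term (ι (f a)) (ι (f b))) {Fr : Fin N → Set}
           (fresh : ∀ {X} → Fr X → ∀ j → ι j ≢ X) where

    open Terminals T

    RD-letter : ∀ {i u} → RD rule term Fr i u → length u ≡ 1 → ∃[ c ] (u ≡ [ c ] × i ≡ ι (f c))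
    RD-letter (terminal {c = a} e) _ = a , refl , only-a e
    RD-letter (terminal {c = b} e) _ = b , refl , only-b e
    RD-letter d@(inner e _ _ _ _) l = ⊥-elim (<-irrefl refl (subst (2 ≤_) l (RD-inner-length d e)))

    RD-bigram : ∀ {i u} → RD rule term Fr i u → length u ≡ 2 →
      ∃[ c ] ∃[ d ] (u ≡ c ∷ d ∷ [] × Fr i × rule i ≡ node (ι (f c)) (ι (f d)))
    RD-bigram (terminal _) ()
    RD-bigram (inner {u = u} {v} e fi r d₁ d₂) l
      with length u in lu | length v in lv | RD-nonempty d₁ | RD-nonempty d₂ | trans (sym (length-++ u)) l
    ... | suc zero | suc zero | _ | _ | _ with RD-letter d₁ lu | RD-letter d₂ lv
    ...   | c , refl , refl | d , refl , refl = c , d , refl , fi , r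
    RD-bigram (inner e fi r d₁ d₂) l | suc (suc _) | suc _ | _ | _ | e′ =
      ⊥-elim (m+1+n≢0 _ (suc-injective (suc-injective e′)))
    RD-bigram (inner e fi r d₁ d₂) l | suc zero | suc (suc _) | _ | _ | ()

    finish₂ : ∀ {w} → RD rule term Fr root w → length w ≡ 2 → Built H (map f w) (1 + k)
    finish₂ d l with RD-bigram d l
    ... | c , d , refl , fr , r = built
      (stop (λ p q → short-count<2 p q (f c ∷ f d ∷ []) (s≤s (s≤s z≤n))) (merge [] (f c) (f d) [] (done _)))
      (embeds-▷ E (fresh fr) r) (▸-fromℕ ι root) refl

    RD-trigram : ∀ {i u} → RD rule term Fr i u → length u ≡ 3 →
      ∃[ c ] ∃[ d ] ∃[ e ] ∃[ Y ] (u ≡ c ∷ d ∷ e ∷ [] × Fr i × Fr Y ×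
        ((rule i ≡ node (ι (f c)) Y × rule Y ≡ node (ι (f d)) (ι (f e))) ⊎
         (rule i ≡ node Y (ι (f e)) × rule Y ≡ node (ι (f c)) (ι (f d)))))
    RD-trigram (terminal _) ()
    RD-trigram (inner {u = u} {v} e fi r d₁ d₂) l
      with length u in lu | length v in lv | RD-nonempty d₁ | RD-nonempty d₂ | trans (sym (length-++ u)) l
    ... | suc zero | suc (suc zero) | _ | _ | _ with RD-letter d₁ lu | RD-bigram d₂ lv
    ...   | c , refl , refl | d , x , refl , fY , rY = c , d , x , _ , refl , fi , fY , inj₁ (r , rY)
    RD-trigram (inner e fi r d₁ d₂) l | suc (suc zero) | suc zero | _ | _ | _ with RD-bigram d₁ lu | RD-letter d₂ lv
    ...   | c , d , refl , fY , rY | x , refl , refl = c , d , x , _ , refl , fi , fY , inj₂ (r , rY)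
    RD-trigram (inner e fi r d₁ d₂) l | suc zero | suc zero | _ | _ | ()
    RD-trigram (inner e fi r d₁ d₂) l | suc zero | suc (suc (suc _)) | _ | _ | ()
    RD-trigram (inner e fi r d₁ d₂) l | suc (suc zero) | suc (suc _) | _ | _ | ()
    RD-trigram (inner e fi r d₁ d₂) l | suc (suc (suc _)) | suc _ | _ | _ | e′ =
      ⊥-elim (m+1+n≢0 _ (suc-injective (suc-injective (suc-injective e′))))

    -- In three letters no bigram occurs twice, so RePair stops. Its final combination is free to
    -- follow whichever of the two bracketings the given grammar uses.
    finish₃ : ∀ {w} → RD rule term Fr root w → length w ≡ 3 → Built H (map f w) (2 + k)
    finish₃ d l with RD-trigram d l
    ... | c , d , e , Y , refl , fr , fY , split = go split
      where
      fresh′ : toℕ Y < toℕ root → ∀ j → (ι ▸ Y) j ≢ root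
      fresh′ lt j with view j
      ... | ‵fromℕ     = λ { refl → <-irrefl refl lt }
      ... | ‵inject₁ j = fresh fr j
      go : _ → Built H (map f (c ∷ d ∷ e ∷ [])) (2 + k)
      go (inj₁ (r , rY)) = built
        (stop (λ p q → short-count<2 p q (f c ∷ f d ∷ f e ∷ []) ≤-refl)
          (merge [ f c ] (f d) (f e) [] (merge [] (inject₁ (f c)) (fromℕ k) [] (done _))))
        (embeds-▷ (embeds-▷ E (fresh fY) rY) (fresh′ (proj₂ (desc r)))
          (trans r (sym (cong₂ node (▸-inject₁ ι Y (f c)) (▸-fromℕ ι Y)))))
        (▸-fromℕ (ι ▸ Y) root) refl
      go (inj₂ (r , rY)) = built
        (stop (λ p q → short-count<2 p q (f c ∷ f d ∷ f e ∷ []) ≤-refl)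
          (merge [] (f c) (f d) [ f e ] (merge [] (fromℕ k) (inject₁ (f e)) [] (done _))))
        (embeds-▷ (embeds-▷ E (fresh fY) rY) (fresh′ (proj₁ (desc r)))
          (trans r (sym (cong₂ node (▸-fromℕ ι Y) (▸-inject₁ ι Y (f e))))))
        (▸-fromℕ (ι ▸ Y) root) refl

  -- `Fr` describes the non-terminals not yet matched, and the bound `2 + i` on their number stands
  -- for optimality. Each level moves the one rule using `b` into the image of `ι` and lowers the
  -- bound by one.
  build : ∀ {i w} → Reduced i w → ∀ {k} {H : SLP k} {ι : Fin k → Fin N} → Embeds H ι →
          (f : Letter → Fin k) → f a ≢ f b → ∀ {term} → Terminals term (ι (f a)) (ι (f b)) →
          ∀ {Fr : Fin N → Set} → (∀ {X} → Fr X → ∀ j → ι j ≢ X) →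
          (∀ {S} → Unique S → All Fr S → length S ≤ 2 + i) →
          RD rule term Fr root w → Built H (map f w) (k + (2 + i))
  build {zero} R {k} {H} E f f≢ T fresh _ d =
    subst (Built H _) (+-comm 2 k) (finish₃ E f T fresh d (reduced-zero-length R))
  build {suc i} {w} R {k} {H} {ι} E f f≢ {term} T {Fr} fresh bound d
    with RD-inner d (≤-trans (reduced-occ-b-suc R) (occ≤length b w))
  ... | root-inner with reduced-expansion desc R root-inner d
  ... | S , t , un , fr , tight = cases ruleX
    where
    open Terminals T
    -- Level `suc i` forces `3 + i` good phrases and at most `3 + i` non-terminals are available for
    -- expansion; the one surplus phrase leaves room for a single use of `b`.
    uses≤1 : uses rule term S ≤ 1
    uses≤1 = +-cancelˡ-≤ (3 + i) _ _ (≤-trans tight (≤-trans (s≤s (bound un fr)) (≤-reflexive (+-comm 1 (3 + i)))))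
    P : Pairing S (ι (f a)) (ι (f b))
    P = pairing desc T uses≤1 t root-inner (reduced-occ-b R) (reduced-occ-a<2occ-b R)
    open Pairing P
    Fr′ : Fin N → Set
    Fr′ i = i ∈ S × i ≢ X
    root≢B : root ≢ ι (f b)
    root≢B e = just≢nothing at-b (subst (λ i → term i ≡ nothing) e root-inner)
    fresh′ : ∀ {Y} → Fr′ Y → ∀ j → (ι ▸ X) j ≢ Y
    fresh′ (Y∈S , Y≢X) j with view j
    ... | ‵fromℕ     = λ e → Y≢X (sym e)
    ... | ‵inject₁ j = fresh (All.lookup fr Y∈S) j
    bound′ : ∀ {S′} → Unique S′ → All Fr′ S′ → length S′ ≤ 2 + i
    -- `X` can be put in front of any list for the next level, which gives a list for the present
    -- one.
    bound′ un′ fr′ = ≤-pred (bound (All.map (λ q e → proj₂ q (sym e)) fr′ ∷ un′)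
                                   (All.lookup fr X∈S ∷ All.map (λ q → All.lookup fr (proj₁ q)) fr′))
    X≢A : X ≢ ι (f a)
    X≢A e = just≢nothing at-a (subst (λ i → term i ≡ nothing) e X-inner)
    g : Letter → Fin (suc k)
    g = next f f≢
    T′ : Terminals term[ X , ι (f a) ] ((ι ▸ X) (g a)) ((ι ▸ X) (g b))
    T′ = subst₂ (Terminals _) (sym (▸-fromℕ ι X)) (sym (▸-inject₁ ι X (f a))) (term-terminals X≢A)
    continue : ∀ {p q v} → rule X ≡ node (ι p) (ι q) → Reduced i v → Best f f≢ i w p q →
               replace p q (map f w) ≡ map g v → RD rule term[ X , ι (f a) ] Fr′ root v →
               Built H (map f w) (k + (3 + i))
    continue {p} {q} r R′ best eq d′
      with build R′ (embeds-▷ E (fresh (All.lookup fr X∈S)) r) g (next-distinct f f≢) T′ fresh′ bound′ d′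
    ... | built rep emb at-root sized = built
      (step p q (≤-trans (reduced-occ-b-suc R) (≤-reflexive (sym (count-best f f≢ best))))
                (best-maximal f f≢ R best) (subst (λ s → Replace _ s _) (sym eq) rep))
      emb at-root (trans sized (sym (+-suc k (2 + i))))
    X-spells : ∀ {p q x y u} → rule X ≡ node p q → term p ≡ just x → term q ≡ just y →
               RD rule term (_∈ S) X u → u ≡ x ∷ y ∷ []
    X-spells r e₁ e₂ d′ = RD-functional d′ (inner X-inner X∈S r (terminal {Fr = _∈ S} e₁) (terminal e₂))
    cases : rule X ≡ node (ι (f a)) (ι (f b)) ⊎ rule X ≡ node (ι (f b)) (ι (f a)) →
            Built H (map f w) (k + (3 + i))
    -- The tree provides some preimage under `σ` and the form of `w` a reduced one; injectivity
    -- identifies them. If `w` began with `b`, the rule `X → ab` would be impossible.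
    cases (inj₁ r) with desubstitute σ σ-++ refl T P (X-spells r at-a at-b) t root≢B | unσ R
    ... | v , refl , d′ | inj₂ (_ , e) = ⊥-elim (σ-head≢b v e)
    ... | v , refl , d′ | inj₁ (v′ , e , R′) with σ-injective v v′ e
    ...   | refl = continue r R′ (inj₁ (refl , refl , v , refl , R′)) (replace-σ f f≢ v) d′
    cases (inj₂ r) with desubstitute τ τ-++ refl T P (X-spells r at-b at-a) t root≢B | unτ R
    ... | v , refl , d′ | inj₂ (w′ , e) = ⊥-elim (τ-last≢b v {w′} e)
    ... | v , refl , d′ | inj₁ (v′ , e , R′) with τ-injective v v′ e
    ...   | refl = continue r R′ (inj₂ (refl , refl , v , refl , R′)) (replace-τ f f≢ v) d′

-- Comparing sizes and concluding

standard : ∀ i → SLP (2 + i)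
standard zero    = [] ▷ leaf b ▷ leaf a
standard (suc i) = standard i ▷ node (fromℕ (1 + i)) (inject₁ (fromℕ i))

-- The recurrence of the Fibonacci words is itself a grammar and bounds the optimum from above. The
-- second component is there for the induction, since a new rule needs the last two non-terminals.
standard-derives : ∀ i → Derives (standard i) (fromℕ (1 + i)) (fib (2 + i)) ×
                         Derives (standard i) (inject₁ (fromℕ i)) (fib (1 + i))
standard-derives zero    = dleaf refl , dleaf refl
standard-derives (suc i) with standard-derives i
... | d , d′ = derives-last d d′ , derives-weaken d

injective⇒surjective : ∀ {p q} (f : Fin p → Fin q) → (∀ {i j} → f i ≡ f j → i ≡ j) → q ≤ p → ∀ y → ∃[ x ] f x ≡ y
injective⇒surjective f inj q≤p y with any? (λ x → f x ≟ y)
... | yes h = h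
... | no h  = ⊥-elim (<-irrefl refl (≤-trans (≤-trans (≤-reflexive (cong suc (sym (length-tabulate f))))
    (unique-length≤ {xs = y ∷ tabulate f} (All.tabulate⁺ (λ x e → h (x , sym e)) ∷ tabulate⁺ inj))) q≤p))

mapRule-inverse : ∀ {p q} {ι : Fin p → Fin q} {π : Fin q → Fin p} → (∀ x → π (ι x) ≡ x) →
                  ∀ r → mapRule π (mapRule ι r) ≡ r
mapRule-inverse h (leaf c)   = refl
mapRule-inverse h (node j k) = cong₂ node (h j) (h k)

≅-refl : ∀ {m} (G : SLP (suc m)) → G ≅ G
≅-refl G = mk⤖ ((λ e → e) , (λ y → y , λ e → e)) , (λ i → sym (mapRule-id (lookup G i))) , refl
  where
  mapRule-id : ∀ {n} (r : Rule n) → mapRule (λ i → i) r ≡ r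
  mapRule-id (leaf c)   = refl
  mapRule-id (node j k) = refl

module _ {m} (G : SLP (suc m)) where
  open Build (lookup G) (lookup-descending G) start

  -- The size hypothesis makes the injective `ι` surjective, and the required renaming is its
  -- inverse.
  embeds⇒≅ : ∀ {K} {H : SLP (suc K)} {ι} → Embeds H ι → ι start ≡ start → suc m ≤ suc K → G ≅ H
  embeds⇒≅ {K} {H} {ι} E at-root m≤K = mk⤖ (π-injective , λ x → ι x , λ { refl → πι x }) , rules ,
    trans (cong π (sym at-root)) (πι start)
    where
    open Embeds E
    π : Fin (suc m) → Fin (suc K)
    π y = proj₁ (injective⇒surjective ι inj m≤K y)
    ιπ : ∀ y → ι (π y) ≡ y
    ιπ y = proj₂ (injective⇒surjective ι inj m≤K y)
    πι : ∀ x → π (ι x) ≡ x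
    πι x = inj (ιπ (ι x))
    π-injective : ∀ {i j} → π i ≡ π j → i ≡ j
    π-injective {i} {j} e = trans (sym (ιπ i)) (trans (cong ι e) (ιπ j))
    rules : ∀ i → lookup H (π i) ≡ mapRule π (lookup G i)
    rules i = sym (trans (cong (λ y → mapRule π (lookup G y)) (sym (ιπ i)))
      (trans (cong (mapRule π) (hom (π i))) (mapRule-inverse πι (lookup H (π i)))))

  opt⇒repair : ∀ i → Opt (fib (3 + i)) G → ∃[ m′ ] Σ[ H ∈ SLP (suc m′) ] (RePair (fib (3 + i)) H × G ≅ H)
  opt⇒repair i (d , optimal) = result
    where
    size : suc m ≤ 3 + i
    size = optimal (standard (1 + i)) (proj₁ (standard-derives (1 + i)))
    open Census (fib-census i G d)
    H₀ : SLP 2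
    H₀ = [] ▷ leaf a ▷ leaf b
    ι₀ : Fin 2 → Fin (suc m)
    ι₀ zero       = A
    ι₀ (suc zero) = B
    f : Letter → Fin 2
    f a = zero
    f b = suc zero
    f≢ : f a ≢ f b
    f≢ ()
    A≢B : A ≢ B
    A≢B = leaf≢leaf {G = G} leafA leafB (λ ())
    -- Two leaves and `1 + i` inner non-terminals already reach the size `3 + i` of the standard
    -- grammar, so an optimal grammar has only one leaf rule for each letter.
    not-third : ∀ {X c} → leafAt G X ≡ just c → X ≢ A → X ≢ B → ⊥
    not-third e X≢A X≢B = <-irrefl refl (≤-trans (s≤s (s≤s (s≤s many)))
      (≤-trans (unique-length≤ ((X≢A ∷ X≢B ∷ leaf∉inner {G = G} e inners) ∷
         (A≢B ∷ leaf∉inner {G = G} leafA inners) ∷ leaf∉inner {G = G} leafB inners ∷ unique)) size))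
    T : Terminals (leafAt G) A B
    T = record { at-a = leafA ; at-b = leafB ; only-a = only-a ; only-b = only-b }
      where
      only-a : ∀ {X} → leafAt G X ≡ just a → X ≡ A
      only-a {X} e with X ≟ A
      ... | yes p = p
      ... | no n  = ⊥-elim (not-third e n (leaf≢leaf {G = G} e leafB (λ ())))
      only-b : ∀ {X} → leafAt G X ≡ just b → X ≡ B
      only-b {X} e with X ≟ B
      ... | yes p = p
      ... | no n  = ⊥-elim (not-third e (leaf≢leaf {G = G} e leafA (λ ())) n)
    E₀ : Embeds H₀ ι₀
    E₀ = record { inj = inj ; hom = hom }
      where
      inj : ∀ {i j} → ι₀ i ≡ ι₀ j → i ≡ j
      inj {zero}     {zero}     _ = refl
      inj {zero}     {suc zero} e = ⊥-elim (A≢B e)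
      inj {suc zero} {zero}     e = ⊥-elim (A≢B (sym e))
      inj {suc zero} {suc zero} _ = refl
      hom : ∀ i → lookup G (ι₀ i) ≡ mapRule ι₀ (lookup H₀ i)
      hom zero       = leafAt-just G leafA
      hom (suc zero) = leafAt-just G leafB
    fresh : ∀ {X} → leafAt G X ≡ nothing → ∀ j → ι₀ j ≢ X
    fresh e zero       refl = just≢nothing leafA e
    fresh e (suc zero) refl = just≢nothing leafB e
    bound : ∀ {S′} → Unique S′ → All (λ X → leafAt G X ≡ nothing) S′ → 2 + length S′ ≤ 3 + i
    bound un in′ = ≤-trans (unique-length≤
      ((A≢B ∷ leaf∉inner {G = G} leafA in′) ∷ leaf∉inner {G = G} leafB in′ ∷ un)) size
    -- Level 0 of `Reduced` is that of F_4, so F_3 is treated separately: its two letters are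
    -- combined without any replacement.
    assemble : ∀ i → suc m ≤ 3 + i → (∀ {S′} → Unique S′ → All (λ X → leafAt G X ≡ nothing) S′ → 2 + length S′ ≤ 3 + i) →
               GrammarOf G (fib (3 + i)) → Built H₀ (map f (fib (3 + i))) (3 + i)
    assemble zero    _ bound d = finish₂ E₀ f T fresh (derives⇒RD G d) refl
    assemble (suc i) _ bound d = subst (λ w → Built H₀ (map f w) (4 + i)) (sym (fib-pal (suc i)))
      (build (fibonacci i) E₀ f f≢ T fresh (λ un in′ → ≤-pred (≤-pred (bound un in′)))
        (subst (RD _ _ _ _) (fib-pal (suc i)) (derives⇒RD G d)))
    occurs : ∀ c w → 1 ≤ occ c w → f c ∈ map f w
    occurs a (a ∷ w) _ = here refl
    occurs b (b ∷ w) _ = here refl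
    occurs a (b ∷ w) p = there (occurs a w p)
    occurs b (a ∷ w) p = there (occurs b w p)
    initial : InitState (fib (3 + i)) H₀ (map f (fib (3 + i)))
    initial = leaves , distinct , occurring , spelling (fib (3 + i))
      where
      leaves : ∀ j → ∃[ c ] lookup H₀ j ≡ leaf c
      leaves zero       = a , refl
      leaves (suc zero) = b , refl
      distinct : ∀ j k c → lookup H₀ j ≡ leaf c → lookup H₀ k ≡ leaf c → j ≡ k
      distinct zero zero _ _ _ = refl
      distinct zero (suc zero) _ refl ()
      distinct (suc zero) zero _ refl ()
      distinct (suc zero) (suc zero) _ _ _ = refl
      occurring : ∀ j → j ∈ map f (fib (3 + i))
      occurring zero       = occurs a _ (fib-occ i a)
      occurring (suc zero) = occurs b _ (fib-occ i b)
      spelling : ∀ w → Pointwise (λ i c → lookup H₀ i ≡ leaf c) (map f w) w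
      spelling []      = []
      spelling (a ∷ w) = refl ∷ spelling w
      spelling (b ∷ w) = refl ∷ spelling w
    result : ∃[ m′ ] Σ[ H ∈ SLP (suc m′) ] (RePair (fib (3 + i)) H × G ≅ H)
    result with assemble i size bound d
    ... | built {K} {H′} rep emb at-root sized =
      K , H′ , (2 , H₀ , _ , initial , rep) , embeds⇒≅ emb at-root (≤-trans size (≤-reflexive (sym sized)))

repair⇒opt : ∀ i {m} (G : SLP (suc m)) → RePair (fib (3 + i)) G → Opt (fib (3 + i)) G
repair⇒opt i G r = repair-grammar r , λ H d →
  ≤-trans (≤-reflexive (repair-size i G r)) (census-size (fib-census i H d))

repair⇒opt-letter : ∀ c {m} (G : SLP (suc m)) → RePair [ c ] G → Opt [ c ] G
repair⇒opt-letter c {m} G rep@(n , G₀ , s , (_ , _ , all , pw) , r) = repair-grammar rep , λ H d → ≤-trans (size pw all r) (s≤s z≤n)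
  where
  -- All initial non-terminals must occur in a string of length one, so there is just one of them.
  size : ∀ {s} → Pointwise (λ i c → lookup G₀ i ≡ leaf c) s [ c ] → (∀ i → i ∈ s) → Replace G₀ s G → suc m ≤ 1
  size (_∷_ {x = x} _ []) all r =
    ≤-trans (≤-reflexive (suc-injective (trans (replace-short-size (s≤s z≤n) r) (+-comm n 1))))
            (injective⇒≤ {f = λ _ → zero} (λ {i} {j} _ → trans (same (all i)) (sym (same (all j)))))
    where
    same : ∀ {i} → i ∈ [ x ] → i ≡ x
    same (here e) = e

opt⇒repair-letter : ∀ c {m} (G : SLP (suc m)) → Opt [ c ] G → RePair [ c ] G
opt⇒repair-letter c G (d , optimal) with optimal ([] ▷ leaf c) (dleaf refl)
opt⇒repair-letter c ([] ▷ node () _) (d , optimal) | s≤s z≤n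
opt⇒repair-letter c ([] ▷ leaf c′) (d , optimal) | s≤s z≤n with only-letter d
  where
  only-letter : ∀ {i w} → Derives ([] ▷ leaf c′) i w → w ≡ [ c′ ]
  only-letter {zero} (dleaf refl)   = refl
  only-letter {zero} (dnode () _ _)
... | refl = 1 , [] ▷ leaf c , [ zero ] ,
  ((λ { zero → c , refl }) , (λ { zero zero _ _ _ → refl }) , (λ { zero → here refl }) , refl ∷ []) ,
  stop (λ _ _ → s≤s z≤n) (done _)

theorem2 : (n : ℕ) → 1 ≤ n →
    (∀ {m} (G : SLP (suc m)) → RePair (fib n) G →
    ∃[ m' ] Σ[ H ∈ SLP (suc m') ] (Opt (fib n) H × G ≅ H)) ×
    (∀ {m} (G : SLP (suc m)) → Opt (fib n) G →
    ∃[ m' ] Σ[ H ∈ SLP (suc m') ] (RePair (fib n) H × G ≅ H))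
theorem2 1 _ = (λ G r → _ , G , repair⇒opt-letter b G r , ≅-refl G) , (λ G o → _ , G , opt⇒repair-letter b G o , ≅-refl G)
theorem2 2 _ = (λ G r → _ , G , repair⇒opt-letter a G r , ≅-refl G) , (λ G o → _ , G , opt⇒repair-letter a G o , ≅-refl G)
theorem2 (suc (suc (suc i))) _ = (λ G r → _ , G , repair⇒opt i G r , ≅-refl G) , (λ G o → opt⇒repair G i o)
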